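{- Let $n\geq 1$ be an integer and let $a,b$ be complex numbers at least one of which equals $q^{ -n}$ (such that no denominator below vanishes). Then $$2\sum_{k=1}^{n}\frac{(a;q)_k\,(b;q)_k\,(a^2b^2;q)_k}{(-ab;q)_k\,(a^2b^2q;q^2)_k}\,\frac{q^k}{1-q^k}=\sum_{k=1}^{2n}\frac{(a^2;q)_k\,(b^2;q)_k\,(ab;q)_k}{(-ab;q)_k\,(a^2b^2q;q^2)_k}\,\frac{q^k}{1-q^k}.$$
   Context: $q$ is a complex number with $0<|q|<1$. For an integer $k\ge 0$, $(x;p)_k=\prod_{j=0}^{k-1}(1-xp^j)$. -}

module Defs where

open import Level using (Level; _⊔_) renaming (suc to lsuc)
open import Algebra.Bundles using (CommutativeRing; Semiring)
open import Algebra.Apartness.Bundles using (HeytingField; HeytingCommutativeRing)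
open import Algebra.Structures using (IsCommutativeRing)
open import Algebra.Solver.Ring.AlmostCommutativeRing using (fromCommutativeRing; _-Raw-AlmostCommutative⟶_; AlmostCommutativeRing; Induced-equivalence)
open import Data.Fin.Base using (toℕ)
open import Data.Fin.Properties using (toℕ<n)
open import Data.Integer.Base as ℤ using (ℤ; +_; -[1+_])
import Data.Integer.Properties as ℤₚ
open import Data.Maybe.Base using (just; nothing)
open import Data.Nat.Base as ℕ using (ℕ; zero; suc; z≤n; s≤s)
import Data.Nat.Properties as ℕₚ
open import Data.Product.Base using (∃; _×_; _,_; proj₁; proj₂)
open import Data.Sum.Base as Sum using (_⊎_; inj₁; inj₂)
open import Function.Base using (_∘_)
open import Relation.Binary.Core using (Rel)
open import Relation.Binary.Definitions using (WeaklyDecidable)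
import Relation.Binary.PropositionalEquality.Core as ≡
open import Relation.Binary.Structures using (IsStrictPartialOrder; IsEquivalence; IsApartnessRelation)
open import Relation.Nullary using (¬_; yes; no; contradiction)
import Algebra.Apartness.Properties.HeytingCommutativeRing as HeytingProperties
import Algebra.Definitions.RawSemiring as RawSemiringDefinitions
import Algebra.Properties.Ring as RingProperties
import Algebra.Properties.Semiring.Mult.TCOptimised as SemiringMult
import Algebra.Solver.Ring as RingSolver
import Relation.Binary.Reasoning.Setoid as SetoidReasoning

module ℤ-Solver {c ℓ₁ : Level} (R : CommutativeRing c ℓ₁) where
  open CommutativeRing R
  open RingProperties ring
  open SemiringMult semiring using (×-homo-+; ×1-homo-*; 1+×) renaming (_×_ to _·_)
  open SetoidReasoning setoid

  fromℤ : ℤ → Carrier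
  fromℤ (+ n)    = n · 1#
  fromℤ -[1+ n ] = - (suc n · 1#)

  private
    fromℤ-cong : ∀ {i j} → i ≡.≡ j → fromℤ i ≈ fromℤ j
    fromℤ-cong ≡.refl = refl

    x-0≈x : ∀ x → x - 0# ≈ x
    x-0≈x x = trans (+-congˡ -0#≈0#) (+-identityʳ x)

    cancel₁ : ∀ x y → (1# + x) - (1# + y) ≈ x - y
    cancel₁ x y = begin
      (1# + x) + - (1# + y)      ≈⟨ +-cong (+-comm 1# x) (sym (-‿+-comm 1# y)) ⟩
      (x + 1#) + (- 1# + - y)    ≈⟨ +-assoc x 1# _ ⟩
      x + (1# + (- 1# + - y))    ≈⟨ +-congˡ (+-assoc 1# _ _) ⟨
      x + ((1# + - 1#) + - y)    ≈⟨ +-congˡ (+-congʳ (-‿inverseʳ 1#)) ⟩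
      x + (0# + - y)             ≈⟨ +-congˡ (+-identityˡ _) ⟩
      x - y                      ∎

    fromℤ-⊖ : ∀ m n → fromℤ (m ℤ.⊖ n) ≈ m · 1# - n · 1#
    fromℤ-⊖ zero    zero    = sym (x-0≈x 0#)
    fromℤ-⊖ zero    (suc n) = sym (+-identityˡ _)
    fromℤ-⊖ (suc m) zero    = sym (x-0≈x _)
    fromℤ-⊖ (suc m) (suc n) = begin
      fromℤ (suc m ℤ.⊖ suc n)      ≈⟨ fromℤ-cong (ℤₚ.[1+m]⊖[1+n]≡m⊖n m n) ⟩
      fromℤ (m ℤ.⊖ n)              ≈⟨ fromℤ-⊖ m n ⟩
      m · 1# - n · 1#              ≈⟨ cancel₁ _ _ ⟨
      (1# + m · 1#) - (1# + n · 1#) ≈⟨ +-cong (1+× m 1#) (-‿cong (1+× n 1#)) ⟨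
      suc m · 1# - suc n · 1#      ∎

    fromℤ-- : ∀ i → fromℤ (ℤ.- i) ≈ - fromℤ i
    fromℤ-- (+ zero)  = sym -0#≈0#
    fromℤ-- (+ suc n) = refl
    fromℤ-- -[1+ n ]  = sym (-‿involutive _)

    fromℤ-+ : ∀ i j → fromℤ (i ℤ.+ j) ≈ fromℤ i + fromℤ j
    fromℤ-+ (+ m)    (+ n)    = ×-homo-+ 1# m n
    fromℤ-+ (+ m)    -[1+ n ] = fromℤ-⊖ m (suc n)
    fromℤ-+ -[1+ m ] (+ n)    = trans (fromℤ-⊖ n (suc m)) (+-comm _ _)
    fromℤ-+ -[1+ m ] -[1+ n ] = begin
      - (suc (suc (m ℕ.+ n)) · 1#)         ≈⟨ -‿cong (reflexive (≡.cong ((_· 1#) ∘ suc) (≡.sym (ℕₚ.+-suc m n)))) ⟩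
      - ((suc m ℕ.+ suc n) · 1#)           ≈⟨ -‿cong (×-homo-+ 1# (suc m) (suc n)) ⟩
      - (suc m · 1# + suc n · 1#)          ≈⟨ -‿+-comm _ _ ⟨
      - (suc m · 1#) + - (suc n · 1#)      ∎

    fromℤ-+* : ∀ m n → fromℤ (+ m ℤ.* + n) ≈ m · 1# * n · 1#
    fromℤ-+* m n = trans (fromℤ-cong (≡.sym (ℤₚ.pos-* m n))) (×1-homo-* m n)

    fromℤ-* : ∀ i j → fromℤ (i ℤ.* j) ≈ fromℤ i * fromℤ j
    fromℤ-* (+ m) (+ n) = fromℤ-+* m n
    fromℤ-* (+ m) -[1+ n ] = begin
      fromℤ (+ m ℤ.* -[1+ n ])            ≈⟨ fromℤ-cong (≡.sym (ℤₚ.neg-distribʳ-* (+ m) (+ suc n))) ⟩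
      fromℤ (ℤ.- (+ m ℤ.* + suc n))       ≈⟨ fromℤ-- (+ m ℤ.* + suc n) ⟩
      - fromℤ (+ m ℤ.* + suc n)           ≈⟨ -‿cong (fromℤ-+* m (suc n)) ⟩
      - (m · 1# * suc n · 1#)             ≈⟨ -‿distribʳ-* _ _ ⟩
      m · 1# * - (suc n · 1#)             ∎
    fromℤ-* -[1+ m ] (+ n) = begin
      fromℤ (-[1+ m ] ℤ.* + n)            ≈⟨ fromℤ-cong (≡.sym (ℤₚ.neg-distribˡ-* (+ suc m) (+ n))) ⟩
      fromℤ (ℤ.- (+ suc m ℤ.* + n))       ≈⟨ fromℤ-- (+ suc m ℤ.* + n) ⟩
      - fromℤ (+ suc m ℤ.* + n)           ≈⟨ -‿cong (fromℤ-+* (suc m) n) ⟩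
      - (suc m · 1# * n · 1#)             ≈⟨ -‿distribˡ-* _ _ ⟩
      - (suc m · 1#) * n · 1#             ∎
    fromℤ-* -[1+ m ] -[1+ n ] = begin
      (suc m ℕ.* suc n) · 1#              ≈⟨ ×1-homo-* (suc m) (suc n) ⟩
      suc m · 1# * suc n · 1#             ≈⟨ -‿involutive _ ⟨
      - (- (suc m · 1# * suc n · 1#))     ≈⟨ -‿cong (-‿distribˡ-* _ _) ⟩
      - (- (suc m · 1#) * suc n · 1#)     ≈⟨ -‿distribʳ-* _ _ ⟩
      - (suc m · 1#) * - (suc n · 1#)     ∎

    almostCommutativeRing : AlmostCommutativeRing c ℓ₁
    almostCommutativeRing = fromCommutativeRing R

    morphism : ℤ.+-*-rawRing -Raw-AlmostCommutative⟶ almostCommutativeRing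
    morphism = record
      { ⟦_⟧    = fromℤ
      ; +-homo = fromℤ-+
      ; *-homo = fromℤ-*
      ; -‿homo = fromℤ--
      ; 0-homo = refl
      ; 1-homo = refl
      }

    _≟′_ : WeaklyDecidable (Induced-equivalence morphism)
    i ≟′ j with i ℤₚ.≟ j
    ... | yes i≡j = just (fromℤ-cong i≡j)
    ... | no  _   = nothing

  open RingSolver _ almostCommutativeRing morphism _≟′_ public

module HeytingFieldOperations {c ℓ₁ ℓ₂ : Level} (F : HeytingField c ℓ₁ ℓ₂) where
  open HeytingField F
  open HeytingCommutativeRing heytingCommutativeRing using (commutativeRing)
  open CommutativeRing commutativeRing using (semiring; ring)
  open HeytingProperties heytingCommutativeRing
  open ℤ-Solver commutativeRing using (solve; _:=_; _:+_; _:*_; _:-_)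
  open RawSemiringDefinitions (Semiring.rawSemiring (CommutativeRing.semiring commutativeRing)) public using (_^_)
  open RawSemiringDefinitions (Semiring.rawSemiring (CommutativeRing.semiring commutativeRing)) using (sum)

  infix  9 _⁻¹[_]
  infixl 7 _/_[_]

  _⁻¹[_] : (x : Carrier) → x # 0# → Carrier
  x ⁻¹[ x#0 ] = proj₁ (#⇒invertible x#0)

  _/_[_] : Carrier → (y : Carrier) → y # 0# → Carrier
  x / y [ y#0 ] = x * y ⁻¹[ y#0 ]

  -- The q-shifted factorial (x; p)ₖ = (1 - x) (1 - x p) ⋯ (1 - x pᵏ⁻¹).

  ⟨_⨾_⟩ : Carrier → Carrier → ℕ → Carrier
  ⟨ x ⨾ p ⟩ zero    = 1#
  ⟨ x ⨾ p ⟩ (suc k) = ⟨ x ⨾ p ⟩ k * (1# - x * p ^ k)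

  -- The sum of f k over 1 ≤ k ≤ n; the bounds are passed to f because its
  -- denominators are only known to be non-zero in that range.

  ∑₁ : (n : ℕ) → ((k : ℕ) → 1 ℕ.≤ k → k ℕ.≤ n → Carrier) → Carrier
  ∑₁ n f = sum {n} (λ i → f (suc (toℕ i)) (s≤s z≤n) (toℕ<n i))

  x*y≈1⇒x#0 : ∀ {x y} → x * y ≈ 1# → x # 0#
  x*y≈1⇒x#0 {x} {y} eq = invertibleʳ⇒# (y , trans (*-congʳ (x-0≈x x)) eq)

  #⇒-#0 : ∀ {x y} → x # y → x - y # 0#
  #⇒-#0 x#y = x*y≈1⇒x#0 (proj₂ (proj₂ (#⇒invertible x#y)))

  -#0⇒# : ∀ {x y} → x - y # 0# → x # y
  -#0⇒# {x} {y} d#0 with #⇒invertible d#0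
  ... | (w , _ , eq) = invertibleʳ⇒# (w , trans (*-congʳ (sym (x-0≈x (x - y)))) eq)

  *#0⇒#0 : ∀ {x y} → x * y # 0# → x # 0#
  *#0⇒#0 {x} {y} xy#0 with #⇒invertible xy#0
  ... | (w , _ , eq) = x*y≈1⇒x#0 (begin
    x * (y * w)        ≈⟨ *-assoc x y w ⟨
    x * y * w          ≈⟨ *-congʳ (x-0≈x (x * y)) ⟨
    (x * y - 0#) * w   ≈⟨ eq ⟩
    1#                 ∎)
    where open SetoidReasoning setoid

  +#0⇒#0⊎#0 : ∀ {x y} → x + y # 0# → x # 0# ⊎ y # 0#
  +#0⇒#0⊎#0 {x} {y} x+y#0 with #-cotrans x+y#0 y
  ... | inj₂ y#0   = inj₂ y#0
  ... | inj₁ x+y#y = inj₁ (#-congʳ (solve 2 (λ x y → x :+ y :- y := x) refl x y) (#⇒-#0 x+y#y))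

-- The real numbers, axiomatised as a Cauchy-complete Archimedean ordered field.
-- Classically these axioms determine ℝ up to isomorphism; constructively,
-- Bishop's regular sequences of rationals satisfy them. Apartness # is the
-- constructive reading of ≠ (classically the two coincide, by tightness).

record RealNumbers (c ℓ₁ ℓ₂ : Level) : Set (lsuc (c ⊔ ℓ₁ ⊔ ℓ₂)) where
  field
    heytingField : HeytingField c ℓ₁ ℓ₂

  open HeytingField heytingField public
  open HeytingCommutativeRing heytingCommutativeRing public using (commutativeRing)
  open RawSemiringDefinitions (Semiring.rawSemiring (CommutativeRing.semiring commutativeRing)) using () renaming (_×_ to _·_)

  infix 4 _<_ _≤_

  field
    _<_                  : Rel Carrier ℓ₂
    isStrictPartialOrder : IsStrictPartialOrder _≈_ _<_
    #⇒<⊎>                : ∀ {x y} → x # y → x < y ⊎ y < x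
    <⇒#                  : ∀ {x y} → x < y → x # y
    +-monoˡ-<            : ∀ {x y} z → x < y → x + z < y + z
    *-pos                : ∀ {x y} → 0# < x → 0# < y → 0# < x * y

  _≤_ : Rel Carrier ℓ₂
  x ≤ y = ¬ (y < x)

  Cauchy : (ℕ → Carrier) → Set _
  Cauchy s = ∀ ε → 0# < ε → ∃ λ N → ∀ m n → N ℕ.≤ m → N ℕ.≤ n → s m - s n < ε

  _ConvergesTo_ : (ℕ → Carrier) → Carrier → Set _
  s ConvergesTo l = ∀ ε → 0# < ε → ∃ λ N → ∀ n → N ℕ.≤ n → (s n - l < ε) × (l - s n < ε)

  field
    archimedean : ∀ x → ∃ λ n → x < n · 1#
    complete    : ∀ s → Cauchy s → ∃ λ l → s ConvergesTo l

module RealProperties {c ℓ₁ ℓ₂ : Level} (R : RealNumbers c ℓ₁ ℓ₂) where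
  open RealNumbers R
  open IsStrictPartialOrder isStrictPartialOrder using (<-respˡ-≈; <-respʳ-≈; asym) renaming (trans to <-trans; irrefl to <-irrefl)
  open HeytingFieldOperations heytingField
  open HeytingProperties heytingCommutativeRing
  open ℤ-Solver commutativeRing using (solve; _:=_; _:+_; _:*_; _:-_; :-_; con)

  x<y⇒0<y-x : ∀ {x y} → x < y → 0# < y - x
  x<y⇒0<y-x {x} x<y = <-respˡ-≈ (-‿inverseʳ x) (+-monoˡ-< (- x) x<y)

  0<y-x⇒x<y : ∀ {x y} → 0# < y - x → x < y
  0<y-x⇒x<y {x} {y} 0<y-x =
    <-respˡ-≈ (+-identityˡ x) (<-respʳ-≈ (solve 2 (λ x y → y :- x :+ x := y) refl x y) (+-monoˡ-< x 0<y-x))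

  x<0⇒0<-x : ∀ {x} → x < 0# → 0# < - x
  x<0⇒0<-x {x} x<0 = <-respʳ-≈ (+-identityˡ (- x)) (x<y⇒0<y-x x<0)

  0<-x⇒x<0 : ∀ {x} → 0# < - x → x < 0#
  0<-x⇒x<0 {x} 0<-x = 0<y-x⇒x<y (<-respʳ-≈ (sym (+-identityˡ (- x))) 0<-x)

  <-cotrans : ∀ {x z} → x < z → ∀ y → x < y ⊎ y < z
  <-cotrans x<z y with #-cotrans (<⇒# x<z) y
  ... | inj₁ x#y with #⇒<⊎> x#y
  ...   | inj₁ x<y = inj₁ x<y
  ...   | inj₂ y<x = inj₂ (<-trans y<x x<z)
  <-cotrans x<z y | inj₂ y#z with #⇒<⊎> y#z
  ...   | inj₁ y<z = inj₂ y<z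
  ...   | inj₂ z<y = inj₁ (<-trans x<z z<y)

  x#0⇒0<x² : ∀ {x} → x # 0# → 0# < x * x
  x#0⇒0<x² {x} x#0 with #⇒<⊎> x#0
  ... | inj₂ 0<x = *-pos 0<x 0<x
  ... | inj₁ x<0 = <-respʳ-≈ (solve 1 (λ x → :- x :* :- x := x :* x) refl x) (*-pos (x<0⇒0<-x x<0) (x<0⇒0<-x x<0))

  0<1 : 0# < 1#
  0<1 = <-respʳ-≈ (*-identityˡ 1#) (x#0⇒0<x² 1#0)

  0≤x² : ∀ x → 0# ≤ x * x
  0≤x² x x²<0 = asym x²<0 (x#0⇒0<x² (*#0⇒#0 (<⇒# x²<0)))

  x<x+y : ∀ {x y z} → x < z → 0# ≤ y → x < z + y
  x<x+y {x} {y} {z} x<z 0≤y with <-cotrans x<z (z + y)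
  ... | inj₁ x<z+y = x<z+y
  ... | inj₂ z+y<z = contradiction
    (<-respˡ-≈ (solve 2 (λ z y → z :+ y :- z := y) refl z y) (<-respʳ-≈ (-‿inverseʳ z) (+-monoˡ-< (- z) z+y<z))) 0≤y

  x+y<z⇒x<z : ∀ {x y z} → 0# ≤ y → x + y < z → x < z
  x+y<z⇒x<z {x} {y} {z} 0≤y x+y<z =
    0<y-x⇒x<y (<-respʳ-≈ (solve 3 (λ x y z → z :- (x :+ y) :+ y := z :- x) refl x y z) (x<x+y (x<y⇒0<y-x x+y<z) 0≤y))

  *-cancel-pos : ∀ {x y} → 0# < y → 0# < x * y → 0# < x
  *-cancel-pos {x} {y} 0<y 0<xy with #⇒<⊎> (*#0⇒#0 (#-sym (<⇒# 0<xy)))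
  ... | inj₂ 0<x = 0<x
  ... | inj₁ x<0 = contradiction 0<xy (asym (0<-x⇒x<0
    (<-respʳ-≈ (solve 2 (λ x y → :- x :* y := :- (x :* y)) refl x y) (*-pos (x<0⇒0<-x x<0) 0<y))))

  x<1∧y<1⇒xy<1 : ∀ {x y} → 0# < y → x < 1# → y < 1# → x * y < 1#
  x<1∧y<1⇒xy<1 {x} {y} 0<y x<1 y<1 = <-trans
    (0<y-x⇒x<y (<-respʳ-≈ (solve 2 (λ x y → (con (+ 1) :- x) :* y := y :- x :* y) refl x y) (*-pos (x<y⇒0<y-x x<1) 0<y)))
    y<1

  x²<1⇒x<1 : ∀ {x} → x * x < 1# → x < 1#
  x²<1⇒x<1 {x} x²<1 with <-cotrans 0<1 x
  ... | inj₂ x<1 = x<1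
  ... | inj₁ 0<x = 0<y-x⇒x<y (*-cancel-pos (<-trans 0<1 1<1+x)
      (<-respʳ-≈ (solve 1 (λ x → con (+ 1) :- x :* x := (con (+ 1) :- x) :* (x :+ con (+ 1))) refl x) (x<y⇒0<y-x x²<1)))
    where
    1<1+x : 1# < x + 1#
    1<1+x = <-respˡ-≈ (+-identityˡ 1#) (+-monoˡ-< 1# 0<x)

module ComplexNumbers {c ℓ₁ ℓ₂ : Level} (R : RealNumbers c ℓ₁ ℓ₂) where
  private
    module ℝ = RealNumbers R
  open ℝ using () renaming (Carrier to ℝ; _<_ to _<ᴿ_; 0# to 0ᴿ; 1# to 1ᴿ) public
  open RealProperties R
  open HeytingFieldOperations ℝ.heytingField using (#⇒-#0; -#0⇒#; *#0⇒#0; +#0⇒#0⊎#0) renaming (_⁻¹[_] to _⁻¹ᴿ[_])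
  open HeytingProperties ℝ.heytingCommutativeRing
  open IsStrictPartialOrder ℝ.isStrictPartialOrder using (<-respˡ-≈; <-respʳ-≈)
  open ℤ-Solver ℝ.commutativeRing using (solve; _:=_; _:+_; _:*_; _:-_; :-_; con)

  infix  8 -_
  infixl 7 _*_
  infixl 6 _+_
  infix  4 _≈_ _#_ _IsModulusOf_

  record ℂ : Set c where
    constructor _+i_
    field
      re im : ℝ

  open ℂ public

  record _≈_ (z w : ℂ) : Set ℓ₁ where
    constructor _,_
    field
      re-≈ : re z ℝ.≈ re w
      im-≈ : im z ℝ.≈ im w

  _#_ : Rel ℂ ℓ₂
  z # w = re z ℝ.# re w ⊎ im z ℝ.# im w

  _+_ _*_ : ℂ → ℂ → ℂ
  z + w = (re z ℝ.+ re w) +i (im z ℝ.+ im w)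
  z * w = (re z ℝ.* re w ℝ.- im z ℝ.* im w) +i (re z ℝ.* im w ℝ.+ im z ℝ.* re w)

  -_ : ℂ → ℂ
  - z = (ℝ.- re z) +i (ℝ.- im z)

  0# 1# : ℂ
  0# = ℝ.0# +i ℝ.0#
  1# = ℝ.1# +i ℝ.0#

  normSq : ℂ → ℝ
  normSq z = re z ℝ.* re z ℝ.+ im z ℝ.* im z

  -- The non-negative square root of re² + im², which completeness makes exist.

  _IsModulusOf_ : ℝ → ℂ → Set (ℓ₁ ⊔ ℓ₂)
  r IsModulusOf z = ℝ.0# ℝ.≤ r × r ℝ.* r ℝ.≈ normSq z

  isEquivalence : IsEquivalence _≈_
  isEquivalence = record
    { refl  = ℝ.refl , ℝ.refl
    ; sym   = λ (p , q) → ℝ.sym p , ℝ.sym q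
    ; trans = λ (p , q) (p′ , q′) → ℝ.trans p p′ , ℝ.trans q q′
    }

  isCommutativeRing : IsCommutativeRing _≈_ _+_ _*_ -_ 0# 1#
  isCommutativeRing = record
    { isRing = record
      { +-isAbelianGroup = record
        { isGroup = record
          { isMonoid = record
            { isSemigroup = record
              { isMagma = record
                { isEquivalence = isEquivalence
                ; ∙-cong = λ (p , q) (p′ , q′) → ℝ.+-cong p p′ , ℝ.+-cong q q′
                }
              ; assoc = λ _ _ _ → ℝ.+-assoc _ _ _ , ℝ.+-assoc _ _ _
              }
            ; identity = (λ _ → ℝ.+-identityˡ _ , ℝ.+-identityˡ _) , (λ _ → ℝ.+-identityʳ _ , ℝ.+-identityʳ _)
            }
          ; inverse = (λ _ → ℝ.-‿inverseˡ _ , ℝ.-‿inverseˡ _) , (λ _ → ℝ.-‿inverseʳ _ , ℝ.-‿inverseʳ _)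
          ; ⁻¹-cong = λ (p , q) → ℝ.-‿cong p , ℝ.-‿cong q
          }
        ; comm = λ _ _ → ℝ.+-comm _ _ , ℝ.+-comm _ _
        }
      ; *-cong = λ (p , q) (p′ , q′) →
          ℝ.+-cong (ℝ.*-cong p p′) (ℝ.-‿cong (ℝ.*-cong q q′)) , ℝ.+-cong (ℝ.*-cong p q′) (ℝ.*-cong q p′)
      ; *-assoc = *-assoc
      ; *-identity = (λ z → *-identityˡ z) , (λ z → trans (*-comm z 1#) (*-identityˡ z))
      ; distrib = *-distribˡ-+ , (λ z x y → trans (*-comm (x + y) z)
          (trans (*-distribˡ-+ z x y) (+-cong (*-comm z x) (*-comm z y))))
      }
    ; *-comm = *-comm
    }
    where
    open IsEquivalence isEquivalence using (trans)
    +-cong : ∀ {x y u v} → x ≈ y → u ≈ v → x + u ≈ y + v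
    +-cong (p , q) (p′ , q′) = ℝ.+-cong p p′ , ℝ.+-cong q q′
    *-comm : ∀ z w → z * w ≈ w * z
    *-comm (a +i b) (x +i y) =
      solve 4 (λ a b x y → a :* x :- b :* y := x :* a :- y :* b) ℝ.refl a b x y ,
      solve 4 (λ a b x y → a :* y :+ b :* x := x :* b :+ y :* a) ℝ.refl a b x y
    *-identityˡ : ∀ z → 1# * z ≈ z
    *-identityˡ (a +i b) =
      solve 2 (λ a b → con (+ 1) :* a :- con (+ 0) :* b := a) ℝ.refl a b ,
      solve 2 (λ a b → con (+ 1) :* b :+ con (+ 0) :* a := b) ℝ.refl a b
    *-assoc : ∀ z w u → (z * w) * u ≈ z * (w * u)
    *-assoc (a +i b) (x +i y) (s +i t) =
      solve 6 (λ a b x y s t → (a :* x :- b :* y) :* s :- (a :* y :+ b :* x) :* t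
        := a :* (x :* s :- y :* t) :- b :* (x :* t :+ y :* s)) ℝ.refl a b x y s t ,
      solve 6 (λ a b x y s t → (a :* x :- b :* y) :* t :+ (a :* y :+ b :* x) :* s
        := a :* (x :* t :+ y :* s) :+ b :* (x :* s :- y :* t)) ℝ.refl a b x y s t
    *-distribˡ-+ : ∀ z w u → z * (w + u) ≈ z * w + z * u
    *-distribˡ-+ (a +i b) (x +i y) (s +i t) =
      solve 6 (λ a b x y s t → a :* (x :+ s) :- b :* (y :+ t)
        := (a :* x :- b :* y) :+ (a :* s :- b :* t)) ℝ.refl a b x y s t ,
      solve 6 (λ a b x y s t → a :* (y :+ t) :+ b :* (x :+ s)
        := (a :* y :+ b :* x) :+ (a :* t :+ b :* s)) ℝ.refl a b x y s t

  commutativeRing : CommutativeRing c ℓ₁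
  commutativeRing = record { isCommutativeRing = isCommutativeRing }

  open CommutativeRing commutativeRing using (_-_) public

  normSq-pos : ∀ {z} → z # 0# → ℝ.0# ℝ.< normSq z
  normSq-pos (inj₁ re#0) = x<x+y (x#0⇒0<x² re#0) (0≤x² _)
  normSq-pos (inj₂ im#0) = <-respʳ-≈ (ℝ.+-comm _ _) (x<x+y (x#0⇒0<x² im#0) (0≤x² _))

  normSq-* : ∀ z w → normSq (z * w) ℝ.≈ normSq z ℝ.* normSq w
  normSq-* (a +i b) (x +i y) = solve 4 (λ a b x y →
    (a :* x :- b :* y) :* (a :* x :- b :* y) :+ (a :* y :+ b :* x) :* (a :* y :+ b :* x)
      := (a :* a :+ b :* b) :* (x :* x :+ y :* y)) ℝ.refl a b x y

  isApartnessRelation : IsApartnessRelation _≈_ _#_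
  isApartnessRelation = record
    { irrefl  = λ { (p , _) (inj₁ h) → ℝ.#-irrefl p h ; (_ , q) (inj₂ h) → ℝ.#-irrefl q h }
    ; sym     = λ { (inj₁ h) → inj₁ (ℝ.#-sym h) ; (inj₂ h) → inj₂ (ℝ.#-sym h) }
    ; cotrans = #-cotrans
    }
    where
    #-cotrans : ∀ {z w} → z # w → ∀ u → z # u ⊎ u # w
    #-cotrans (inj₁ h) u with ℝ.#-cotrans h (re u)
    ... | inj₁ p = inj₁ (inj₁ p)
    ... | inj₂ p = inj₂ (inj₁ p)
    #-cotrans (inj₂ h) u with ℝ.#-cotrans h (im u)
    ... | inj₁ p = inj₁ (inj₂ p)
    ... | inj₂ p = inj₂ (inj₂ p)

  complexField : HeytingField c ℓ₁ ℓ₂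
  complexField = record
    { isHeytingField = record
      { isHeytingCommutativeRing = record
        { isCommutativeRing   = isCommutativeRing
        ; isApartnessRelation = isApartnessRelation
        ; #⇒invertible        = #⇒invertible
        ; invertible⇒#        = λ (w , _ , eq) → invertible⇒# w eq
        }
      ; tight = λ z w →
          (λ ¬z#w → proj₁ (ℝ.tight (re z) (re w)) (¬z#w ∘ inj₁) , proj₁ (ℝ.tight (im z) (im w)) (¬z#w ∘ inj₂)) ,
          IsApartnessRelation.irrefl isApartnessRelation
      }
    }
    where
    open CommutativeRing commutativeRing using (trans; *-comm)

    -- (a + i b)⁻¹ = (a - i b) / (a² + b²)
    #⇒invertible : ∀ {z w} → z # w → ∃ λ u → (u * (z - w) ≈ 1#) × ((z - w) * u ≈ 1#)
    #⇒invertible {z} {w} z#w = u , trans (*-comm u (z - w)) d*u≈1 , d*u≈1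
      where
      d#0 : (z - w) # 0#
      d#0 = Sum.map #⇒-#0 #⇒-#0 z#w
      N#0 : normSq (z - w) ℝ.# ℝ.0#
      N#0 = ℝ.#-sym (ℝ.<⇒# (normSq-pos d#0))
      a b n : ℝ
      a = re (z - w)
      b = im (z - w)
      n = normSq (z - w) ⁻¹ᴿ[ N#0 ]
      Nn≈1 : (normSq (z - w) ℝ.- ℝ.0#) ℝ.* n ℝ.≈ ℝ.1#
      Nn≈1 = proj₂ (proj₂ (ℝ.#⇒invertible N#0))
      u : ℂ
      u = (a ℝ.* n) +i (ℝ.- b ℝ.* n)
      d*u≈1 : (z - w) * u ≈ 1#
      d*u≈1 =
        ℝ.trans (solve 3 (λ a b n → a :* (a :* n) :- b :* (:- b :* n)
          := (a :* a :+ b :* b :- con (+ 0)) :* n) ℝ.refl a b n) Nn≈1 ,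
        solve 3 (λ a b n → a :* (:- b :* n) :+ b :* (a :* n) := con (+ 0)) ℝ.refl a b n

    invertible⇒# : ∀ {z w} u → (z - w) * u ≈ 1# → z # w
    invertible⇒# {z} {w} u (p , _) with +#0⇒#0⊎#0 (#-congʳ (ℝ.sym p) 1#0)
    ... | inj₁ h = inj₁ (-#0⇒# (*#0⇒#0 h))
    ... | inj₂ h = inj₂ (-#0⇒# (*#0⇒#0 (#-congʳ
      (solve 2 (λ b y → con (+ 0) :- (:- (b :* y)) := b :* y) ℝ.refl (im (z - w)) (im u)) (#⇒-#0 (ℝ.#-sym h)))))

  open HeytingFieldOperations complexField public using (_^_; _⁻¹[_]; _/_[_]; ⟨_⨾_⟩; ∑₁)

  ∣q∣>0⇒q#0 : ∀ {q r} → r IsModulusOf q → ℝ.0# ℝ.< r → q # 0#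
  ∣q∣>0⇒q#0 (_ , r²≈N) 0<r =
    Sum.map *#0⇒#0 *#0⇒#0 (+#0⇒#0⊎#0 (ℝ.#-sym (ℝ.<⇒# (<-respʳ-≈ r²≈N (ℝ.*-pos 0<r 0<r)))))

  ∣q∣<1⇒1-qᵏ#0 : ∀ {q r} → r IsModulusOf q → ℝ.0# ℝ.< r → r ℝ.< ℝ.1# → ∀ k → 1 ℕ.≤ k → 1# - q ^ k # 0#
  ∣q∣<1⇒1-qᵏ#0 {q} {r} (_ , r²≈N) 0<r r<1 (suc k) _ =
    inj₁ (#⇒-#0 (ℝ.#-sym (ℝ.<⇒# (x²<1⇒x<1 (x+y<z⇒x<z (0≤x² _) (normSq-<1 k))))))
    where
    N<1 : normSq q ℝ.< ℝ.1#
    N<1 = <-respˡ-≈ r²≈N (x<1∧y<1⇒xy<1 0<r r<1 r<1)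
    N>0 : ℝ.0# ℝ.< normSq q
    N>0 = <-respʳ-≈ r²≈N (ℝ.*-pos 0<r 0<r)
    normSq-<1 : ∀ k → normSq (q ^ suc k) ℝ.< ℝ.1#
    normSq-<1 zero    = <-respˡ-≈ (ℝ.sym (ℝ.trans (normSq-* q 1#)
      (solve 1 (λ n → n :* (con (+ 1) :* con (+ 1) :+ con (+ 0) :* con (+ 0)) := n) ℝ.refl (normSq q)))) N<1
    normSq-<1 (suc k) = <-respˡ-≈ (ℝ.sym (ℝ.trans (normSq-* q (q ^ suc k)) (ℝ.*-comm _ _)))
      (x<1∧y<1⇒xy<1 N>0 (normSq-<1 k) N<1)

{-# OPTIONS --safe #-}

-- This is the first-order part, at c = 1, of Jackson's terminating q-Clausen
-- formula: the square of the 4φ3 with upper parameters a, b, a²b²/c, c is a 5φ4,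
-- and to first order in 1 - c both sides read 1 + (1 - c) (...).
--
-- Fix α = a b and let L and R be the two sums. As functions of a (with b = α / a)
-- both satisfy the inhomogeneous form of the q-difference equation of the
-- continuous q-ultraspherical polynomials, which links a q, a and a / q, and the
-- inhomogeneity of R is twice that of L. So 2 L - R satisfies the homogeneous
-- equation. At a = 1 it is zero and the coefficient of a q vanishes; hence it
-- vanishes at a = q⁻¹, q⁻², ... as long as the leading coefficient, which contains
-- 1 - α² qʲ, is non-zero. This holds for α = q, q², q³, ..., and for a = q⁻ⁿ the
-- identity with cleared denominators is polynomial in b, so it holds for all b.

module Submission where

open import Defs
open import Algebra.Apartness.Bundles using (HeytingField; HeytingCommutativeRing)
open import Algebra.Bundles using (CommutativeRing; Semiring)
open import Data.Fin.Base using (Fin; toℕ; inject₁; fromℕ)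
open import Data.Fin.Properties using (toℕ<n; toℕ-inject₁; toℕ-fromℕ)
open import Data.Integer.Base using (+_)
open import Data.Nat.Base as ℕ using (ℕ; zero; suc; z≤n; s≤s)
open import Data.Nat.Properties using (≤-trans; m≤m+n)
import Data.Nat.Properties as ℕₚ
open import Data.Product.Base using (∃; _×_; _,_; proj₁; proj₂)
open import Data.Sum.Base using (_⊎_; inj₁; inj₂)
open import Function.Base using (_∘_)
open import Level using (Level; Lift; lift; _⊔_)
import Relation.Binary.PropositionalEquality.Core as ≡
import Algebra.Apartness.Properties.HeytingCommutativeRing as HeytingProperties
import Algebra.Definitions.RawSemiring as RawSemiringDefinitions
import Algebra.Properties.Group as GroupProperties
import Algebra.Properties.Monoid.Sum as MonoidSum
import Algebra.Properties.Semiring.Exp as SemiringExp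
import Relation.Binary.Reasoning.Setoid as SetoidReasoning

-- Polynomial functions on a Heyting field and their zeros.

module FieldProperties {c ℓ₁ ℓ₂ : Level} (F : HeytingField c ℓ₁ ℓ₂) where
  open HeytingField F
  open HeytingCommutativeRing heytingCommutativeRing using (commutativeRing)
  open HeytingProperties heytingCommutativeRing using (x-0≈x)
  open HeytingFieldOperations F
  open ℤ-Solver commutativeRing using (solve; _:=_; _:+_; _:*_; _:-_; :-_; con)
  open SetoidReasoning setoid

  x⁻¹*x≈1 : ∀ {x} (x#0 : x # 0#) → x ⁻¹[ x#0 ] * x ≈ 1#
  x⁻¹*x≈1 {x} x#0 = trans (*-congˡ (sym (x-0≈x x))) (proj₁ (proj₂ (#⇒invertible x#0)))

  x*[y/x]≈y : ∀ {x} y (x#0 : x # 0#) → x * (y / x [ x#0 ]) ≈ y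
  x*[y/x]≈y {x} y x#0 = begin
    x * (y * w)        ≈⟨ solve 3 (λ x y w → x :* (y :* w) := w :* x :* y) refl x y w ⟩
    w * x * y          ≈⟨ *-congʳ (x⁻¹*x≈1 x#0) ⟩
    1# * y             ≈⟨ *-identityˡ y ⟩
    y                  ∎
    where w = x ⁻¹[ x#0 ]

  *-cancelˡ-#0 : ∀ {x y} → x # 0# → x * y ≈ 0# → y ≈ 0#
  *-cancelˡ-#0 {x} {y} x#0 xy≈0 = begin
    y                  ≈⟨ *-identityˡ y ⟨
    1# * y             ≈⟨ *-congʳ (x⁻¹*x≈1 x#0) ⟨
    w * x * y          ≈⟨ *-assoc w x y ⟩
    w * (x * y)        ≈⟨ *-congˡ xy≈0 ⟩
    w * 0#             ≈⟨ zeroʳ w ⟩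
    0#                 ∎
    where w = x ⁻¹[ x#0 ]

  x≈0⇒y*x≈0 : ∀ {x} y → x ≈ 0# → y * x ≈ 0#
  x≈0⇒y*x≈0 y x≈0 = trans (*-congˡ x≈0) (zeroʳ y)

  x≈0⇒x*y≈0 : ∀ {x} y → x ≈ 0# → x * y ≈ 0#
  x≈0⇒x*y≈0 y x≈0 = trans (*-congʳ x≈0) (zeroˡ y)

  -- Polynomial functions of degree at most d, described by their difference
  -- quotients: f x = f x₀ + (x - x₀) g x with g of degree at most d - 1.

  Deg : ℕ → (Carrier → Carrier) → Set (c ⊔ ℓ₁)
  Deg zero    f = Lift c (∀ x y → f x ≈ f y)
  Deg (suc d) f = ∀ x₀ → ∃ λ g → Deg d g × (∀ x → f x ≈ f x₀ + (x - x₀) * g x)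

  IsPolynomial : (Carrier → Carrier) → Set (c ⊔ ℓ₁)
  IsPolynomial f = ∃ λ d → Deg d f

  private variable
    f g : Carrier → Carrier

  Deg-suc : ∀ d → Deg d f → Deg (suc d) f
  Deg-suc {f} zero    (lift f-const) x₀ = (λ _ → 0#) , lift (λ _ _ → refl) , λ x → begin
    f x                    ≈⟨ f-const x x₀ ⟩
    f x₀                   ≈⟨ solve 2 (λ y d → y := y :+ d :* con (+ 0)) refl (f x₀) (x - x₀) ⟩
    f x₀ + (x - x₀) * 0#   ∎
  Deg-suc (suc d) Df x₀ = let (g , Dg , eq) = Df x₀ in g , Deg-suc d Dg , eq

  Deg-+ˡ : ∀ e d → Deg d f → Deg (e ℕ.+ d) f
  Deg-+ˡ zero    d Df = Df
  Deg-+ˡ (suc e) d Df = Deg-suc (e ℕ.+ d) (Deg-+ˡ e d Df)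

  Deg-+ʳ : ∀ e d → Deg d f → Deg (d ℕ.+ e) f
  Deg-+ʳ {f} e d Df = ≡.subst (λ k → Deg k f) (ℕₚ.+-comm e d) (Deg-+ˡ e d Df)

  Deg-resp-≈ : ∀ d → (∀ x → f x ≈ g x) → Deg d f → Deg d g
  Deg-resp-≈ zero    f≈g (lift f-const) = lift (λ x y → trans (sym (f≈g x)) (trans (f-const x y) (f≈g y)))
  Deg-resp-≈ (suc d) f≈g Df x₀ = let (h , Dh , eq) = Df x₀ in
    h , Dh , λ x → trans (sym (f≈g x)) (trans (eq x) (+-congʳ (f≈g x₀)))

  Deg-const* : ∀ d k → Deg d f → Deg d (λ x → k * f x)
  Deg-const* zero    k (lift f-const) = lift (λ x y → *-congˡ (f-const x y))
  Deg-const* {f} (suc d) k Df x₀ = let (g , Dg , eq) = Df x₀ in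
    (λ x → k * g x) , Deg-const* d k Dg , λ x → trans (*-congˡ (eq x))
      (solve 4 (λ k y δ z → k :* (y :+ δ :* z) := k :* y :+ δ :* (k :* z)) refl k (f x₀) (x - x₀) (g x))

  Deg-+ : ∀ d → Deg d f → Deg d g → Deg d (λ x → f x + g x)
  Deg-+ zero    (lift f-const) (lift g-const) = lift (λ x y → +-cong (f-const x y) (g-const x y))
  Deg-+ {f} {g} (suc d) Df Dg x₀ = let (f′ , Df′ , eq) = Df x₀ ; (g′ , Dg′ , eq′) = Dg x₀ in
    (λ x → f′ x + g′ x) , Deg-+ d Df′ Dg′ , λ x → trans (+-cong (eq x) (eq′ x))
      (solve 5 (λ y z δ u v → (y :+ δ :* u) :+ (z :+ δ :* v) := (y :+ z) :+ δ :* (u :+ v)) refl (f x₀) (g x₀) (x - x₀) (f′ x) (g′ x))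

  Deg-* : ∀ d e → Deg d f → Deg e g → Deg (d ℕ.+ e) (λ x → f x * g x)
  Deg-* {f} zero e (lift f-const) Dg = Deg-resp-≈ e (λ x → *-congʳ (f-const 0# x)) (Deg-const* e (f 0#) Dg)
  -- `Deg-suc` bounds the degree of `g′` by `e` instead of `e - 1`. The sum still fits into `d + e`,
  -- and the case `e = zero`, where `Deg e g` holds no difference quotient, is covered as well.
  Deg-* {f} {g} (suc d) e Df Dg x₀ = let (f′ , Df′ , eq) = Df x₀ ; (g′ , Dg′ , eq′) = Deg-suc e Dg x₀ in
    (λ x → f′ x * g x + f x₀ * g′ x) ,
    Deg-+ (d ℕ.+ e) (Deg-* d e Df′ Dg) (Deg-+ˡ d e (Deg-const* e (f x₀) Dg′)) ,
    λ x → begin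
      f x * g x                                    ≈⟨ *-congʳ (eq x) ⟩
      (f x₀ + (x - x₀) * f′ x) * g x               ≈⟨ solve 4 (λ y δ u v → (y :+ δ :* u) :* v := y :* v :+ δ :* (u :* v)) refl (f x₀) (x - x₀) (f′ x) (g x) ⟩
      f x₀ * g x + (x - x₀) * (f′ x * g x)         ≈⟨ +-congʳ (*-congˡ (eq′ x)) ⟩
      f x₀ * (g x₀ + (x - x₀) * g′ x) + (x - x₀) * (f′ x * g x)
        ≈⟨ solve 5 (λ y z δ u v → y :* (z :+ δ :* v) :+ δ :* u := y :* z :+ δ :* (u :+ y :* v)) refl (f x₀) (g x₀) (x - x₀) (f′ x * g x) (g′ x) ⟩
      f x₀ * g x₀ + (x - x₀) * (f′ x * g x + f x₀ * g′ x) ∎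

  const-polynomial : ∀ k → IsPolynomial (λ _ → k)
  const-polynomial k = 0 , lift (λ _ _ → refl)

  id-polynomial : IsPolynomial (λ x → x)
  id-polynomial = 1 , λ x₀ → (λ _ → 1#) , lift (λ _ _ → refl) , λ x →
    solve 2 (λ x y → x := y :+ (x :- y) :* con (+ 1)) refl x x₀

  +-polynomial : IsPolynomial f → IsPolynomial g → IsPolynomial (λ x → f x + g x)
  +-polynomial (d , Df) (e , Dg) = d ℕ.+ e , Deg-+ (d ℕ.+ e) (Deg-+ʳ e d Df) (Deg-+ˡ d e Dg)

  *-polynomial : IsPolynomial f → IsPolynomial g → IsPolynomial (λ x → f x * g x)
  *-polynomial (d , Df) (e , Dg) = d ℕ.+ e , Deg-* d e Df Dg

  neg-polynomial : IsPolynomial f → IsPolynomial (λ x → - f x)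
  neg-polynomial {f} (d , Df) = d , Deg-resp-≈ d
    (λ x → solve 1 (λ y → (con (+ 0) :- con (+ 1)) :* y := :- y) refl (f x)) (Deg-const* d (0# - 1#) Df)

  -- Splitting off the zero `x 0` lowers the degree, and the quotient vanishes at the later points
  -- because `x j - x 0` is invertible. An infinite sequence of zeros spares counting them against
  -- `d`.
  Deg-vanishes : ∀ d → Deg d f → (x : ℕ → Carrier) → (∀ {i j} → i ℕ.< j → x j # x i) →
                 (∀ i → f (x i) ≈ 0#) → ∀ y → f y ≈ 0#
  Deg-vanishes zero (lift f-const) x _ f≈0 y = trans (f-const y (x 0)) (f≈0 0)
  Deg-vanishes {f} (suc d) Df x x#x f≈0 y with Df (x 0)
  ... | (g , Dg , eq) = trans (f≈ y) (x≈0⇒y*x≈0 _ (Deg-vanishes d Dg (x ∘ suc) (x#x ∘ s≤s)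
      (λ i → *-cancelˡ-#0 (#⇒-#0 (x#x (s≤s z≤n))) (trans (sym (f≈ (x (suc i)))) (f≈0 (suc i)))) y))
    where
    f≈ : ∀ y → f y ≈ (y - x 0) * g y
    f≈ y = trans (eq y) (trans (+-congʳ (f≈0 0)) (+-identityˡ _))

  polynomial-vanishes : IsPolynomial f → (x : ℕ → Carrier) → (∀ {i j} → i ℕ.< j → x j # x i) →
                        (∀ i → f (x i) ≈ 0#) → ∀ y → f y ≈ 0#
  polynomial-vanishes (d , Df) = Deg-vanishes d Df

-- Shifted factorials.

module QSeries {ℓ ℓ₁ ℓ₂ : Level} (F : HeytingField ℓ ℓ₁ ℓ₂) (q : HeytingField.Carrier F) where
  open HeytingField F
  open HeytingCommutativeRing heytingCommutativeRing using (commutativeRing)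
  open HeytingFieldOperations F
  open FieldProperties F
  open HeytingProperties heytingCommutativeRing using (x#0y#0→xy#0; #-congʳ; 1#0)
  open CommutativeRing commutativeRing using (semiring; +-monoid; +-group)
  open SemiringExp semiring using (^-homo-*)
  open GroupProperties +-group using (x∙y⁻¹≈ε⇒x≈y)
  open MonoidSum +-monoid using (sum; sum-init-last)
  open ℤ-Solver commutativeRing using (solve; _:=_; _:+_; _:*_; _:-_; :-_; con; Polynomial)
  open SetoidReasoning setoid

  private
    1ₚ : ∀ {n} → Polynomial n
    1ₚ = con (+ 1)

    minus-cong : ∀ {x y z w} → x ≈ y → z ≈ w → x - z ≈ y - w
    minus-cong p r = +-cong p (-‿cong r)

  2# : Carrier
  2# = 1# + 1#

  ⟨_⟩ : Carrier → ℕ → Carrier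
  ⟨ x ⟩ = ⟨ x ⨾ q ⟩

  ⟨⟩-cong : ∀ {x y} k → x ≈ y → ⟨ x ⟩ k ≈ ⟨ y ⟩ k
  ⟨⟩-cong zero    x≈y = refl
  ⟨⟩-cong (suc k) x≈y = *-cong (⟨⟩-cong k x≈y) (minus-cong refl (*-congʳ x≈y))

  ⟨⟩-suc : ∀ x k → ⟨ x ⟩ (suc k) ≈ (1# - x) * ⟨ x * q ⟩ k
  ⟨⟩-suc x zero    = solve 1 (λ x → 1ₚ :* (1ₚ :- x :* 1ₚ) := (1ₚ :- x) :* 1ₚ) refl x
  ⟨⟩-suc x (suc k) = trans (*-congʳ (⟨⟩-suc x k))
    (solve 4 (λ x q P X → (1ₚ :- x) :* X :* (1ₚ :- x :* (q :* P)) := (1ₚ :- x) :* (X :* (1ₚ :- x :* q :* P)))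
      refl x q (q ^ k) (⟨ x * q ⟩ k))

  ⟨⟩-suc² : ∀ x k → ⟨ x ⟩ (suc (suc k)) ≈ (1# - x) * (1# - x * q) * ⟨ x * (q * q) ⟩ k
  ⟨⟩-suc² x k = begin
    ⟨ x ⟩ (suc (suc k))                            ≈⟨ ⟨⟩-suc x (suc k) ⟩
    (1# - x) * ⟨ x * q ⟩ (suc k)                    ≈⟨ *-congˡ (⟨⟩-suc (x * q) k) ⟩
    (1# - x) * ((1# - x * q) * ⟨ x * q * q ⟩ k)     ≈⟨ *-assoc _ _ _ ⟨
    (1# - x) * (1# - x * q) * ⟨ x * q * q ⟩ k       ≈⟨ *-congˡ (⟨⟩-cong k (*-assoc x q q)) ⟩
    (1# - x) * (1# - x * q) * ⟨ x * (q * q) ⟩ k     ∎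

  -- This terminates the series at `x = q⁻ʲ`: the factor of index `j` is `1 - x qʲ`.
  ⟨⟩-zero : ∀ {x j} k → x * q ^ j ≈ 1# → j ℕ.< k → ⟨ x ⟩ k ≈ 0#
  ⟨⟩-zero {x} {j} (suc k) xqʲ≈1 (s≤s j≤k) with ℕₚ.m≤n⇒m<n∨m≡n j≤k
  ... | inj₁ j<k    = x≈0⇒x*y≈0 _ (⟨⟩-zero k xqʲ≈1 j<k)
  ... | inj₂ ≡.refl = x≈0⇒y*x≈0 _ (trans (minus-cong refl xqʲ≈1) (-‿inverseʳ 1#))

  -- Finite sums with cleared denominators.

  -- cleared d y N = D N * Σ_{k<N} y k / D (k + 1), where D N = Π_{k<N} d k.

  cleared : (d y : ℕ → Carrier) → ℕ → Carrier
  cleared d y zero    = 0#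
  cleared d y (suc k) = cleared d y k * d k + y k

  cleared-cong : ∀ {d d′ y y′} → (∀ k → d k ≈ d′ k) → (∀ k → y k ≈ y′ k) → ∀ N → cleared d y N ≈ cleared d′ y′ N
  cleared-cong d≈ y≈ zero    = refl
  cleared-cong d≈ y≈ (suc k) = +-cong (*-cong (cleared-cong d≈ y≈ k) (d≈ k)) (y≈ k)

  cleared-linear : ∀ d y z s t N →
    s * cleared d y N - t * cleared d z N ≈ cleared d (λ k → s * y k - t * z k) N
  cleared-linear d y z s t zero    = solve 2 (λ s t → s :* con (+ 0) :- t :* con (+ 0) := con (+ 0)) refl s t
  cleared-linear d y z s t (suc k) = trans
    (solve 7 (λ s t Y Z d y z → s :* (Y :* d :+ y) :- t :* (Z :* d :+ z) := (s :* Y :- t :* Z) :* d :+ (s :* y :- t :* z))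
      refl s t (cleared d y k) (cleared d z k) (d k) (y k) (z k))
    (+-congʳ (*-congʳ (cleared-linear d y z s t k)))

  cleared-* : ∀ d y s N → s * cleared d y N ≈ cleared d (λ k → s * y k) N
  cleared-* d y s zero    = zeroʳ s
  cleared-* d y s (suc k) = trans
    (solve 4 (λ s Y d y → s :* (Y :* d :+ y) := s :* Y :* d :+ s :* y) refl s (cleared d y k) (d k) (y k))
    (+-congʳ (*-congʳ (cleared-* d y s k)))

  -- `ρ k` over the product of `d 0`, ..., `d k` is a closed form of the partial sum; the recursion
  -- for `ρ` is the relation between consecutive partial sums, multiplied by the common denominator.
  cleared-telescope : ∀ d y (ρ : ℕ → Carrier) → y 0 ≈ ρ 0 → (∀ k → ρ (suc k) ≈ ρ k * d (suc k) + y (suc k)) →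
                      ∀ k → cleared d y (suc k) ≈ ρ k
  cleared-telescope d y ρ y₀≈ρ₀ ρ-suc zero    = trans (+-congʳ (zeroˡ _)) (trans (+-identityˡ _) y₀≈ρ₀)
  cleared-telescope d y ρ y₀≈ρ₀ ρ-suc (suc k) =
    trans (+-congʳ (*-congʳ (cleared-telescope d y ρ y₀≈ρ₀ ρ-suc k))) (sym (ρ-suc k))

  cleared-zero : ∀ d y N → (∀ k → y k ≈ 0#) → cleared d y N ≈ 0#
  cleared-zero d y zero    y≈0 = refl
  cleared-zero d y (suc k) y≈0 = trans (+-cong (x≈0⇒x*y≈0 _ (cleared-zero d y k y≈0)) (y≈0 k)) (+-identityˡ 0#)

  -- Each summand is known only through its product with its own denominator, so the way in which
  -- the division was carried out does not matter.
  cleared-sum : ∀ (D d y : ℕ → Carrier) → (∀ k → D (suc k) ≈ D k * d k) → ∀ N (t : Fin N → Carrier) →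
                (∀ i → D (suc (toℕ i)) * t i ≈ y (toℕ i)) → D N * sum t ≈ cleared d y N
  cleared-sum D d y D-suc zero    t t-spec = zeroʳ (D 0)
  cleared-sum D d y D-suc (suc N) t t-spec = begin
    D (suc N) * sum t                                     ≈⟨ *-congˡ (sum-init-last t) ⟩
    D (suc N) * (sum (t ∘ inject₁) + t (fromℕ N))         ≈⟨ distribˡ _ _ _ ⟩
    D (suc N) * sum (t ∘ inject₁) + D (suc N) * t (fromℕ N)
      ≈⟨ +-cong (*-congʳ (D-suc N)) (≡.subst (λ k → D (suc k) * t (fromℕ N) ≈ y k) (toℕ-fromℕ N) (t-spec (fromℕ N))) ⟩
    D N * d N * sum (t ∘ inject₁) + y N                   ≈⟨ +-congʳ (solve 3 (λ D d s → D :* d :* s := D :* s :* d) refl (D N) (d N) _) ⟩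
    D N * sum (t ∘ inject₁) * d N + y N
      ≈⟨ +-congʳ (*-congʳ (cleared-sum D d y D-suc N (t ∘ inject₁)
           (λ i → ≡.subst (λ k → D (suc k) * t (inject₁ i) ≈ y k) (toℕ-inject₁ i) (t-spec (inject₁ i))))) ⟩
    cleared d y (suc N) ∎

  -- The left sum has `n` terms and the right one `2n`. Zero numerators pad the shorter sum up to
  -- the common denominator.
  cleared-extend : ∀ (D d y : ℕ → Carrier) → (∀ k → D (suc k) ≈ D k * d k) → ∀ {n S} → (∀ k → n ℕ.≤ k → y k ≈ 0#) →
                   D n * S ≈ cleared d y n → ∀ j → D (j ℕ.+ n) * S ≈ cleared d y (j ℕ.+ n)
  cleared-extend D d y D-suc y≈0 eq zero    = eq
  cleared-extend D d y D-suc {n} {S} y≈0 eq (suc j) = begin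
    D (suc (j ℕ.+ n)) * S                        ≈⟨ *-congʳ (D-suc (j ℕ.+ n)) ⟩
    D (j ℕ.+ n) * d (j ℕ.+ n) * S                ≈⟨ solve 3 (λ D d s → D :* d :* s := D :* s :* d) refl _ _ S ⟩
    D (j ℕ.+ n) * S * d (j ℕ.+ n)                ≈⟨ *-congʳ (cleared-extend D d y D-suc y≈0 eq j) ⟩
    cleared d y (j ℕ.+ n) * d (j ℕ.+ n)          ≈⟨ +-identityʳ _ ⟨
    cleared d y (j ℕ.+ n) * d (j ℕ.+ n) + 0#     ≈⟨ +-congˡ (y≈0 _ (ℕₚ.m≤n+m n j)) ⟨
    cleared d y (suc (j ℕ.+ n))                  ∎

  -- Terms of a parameter shift and their q-difference equation.

  -- With `α = a b`, this is the quotient of the denominators of index `k + 1` and `k`.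
  den : Carrier → ℕ → Carrier
  den α k = (1# + α * q ^ k) * (1# - α * α * q * (q ^ k * q ^ k))

  -- The cofactor in `(1 - A K)(1 - A q K)(1 - C)(1 - C q) - (1 - A)(1 - A q)(1 - C K)(1 - C q K) =
  -- (A - C)(1 - K) h`, whose left side vanishes at `A = C` and at `K = 1`.
  h : Carrier → Carrier → Carrier → Carrier
  h A C K = (1# + q) * (1# + A * C * q * K) - q * (1# + K) * (A + C)

  -- The quotient that appears in `shiftᵣ`. At index 0 the factorials are too short to have common
  -- factors, hence the separate clause.
  χ : Carrier → Carrier → ℕ → Carrier
  χ A C zero    = 1# + q
  χ A C (suc k) = ⟨ A * (q * q) ⟩ k * ⟨ C * (q * q) ⟩ k * h A C (q ^ suc (suc k))

  -- With α = a c q, these are the k-th terms of the differences of the two sums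
  -- between the parameters (a q, c) and (a, c q), divided by a - c, resp. a² - c²;
  -- the factor 1 - qᵏ cancels. Index k stands for the paper's k + 1.

  stepₗ stepᵣ step : (α a c : Carrier) → ℕ → Carrier
  stepₗ α a c k = q ^ suc k * ⟨ α * α ⟩ (suc k) * (⟨ a * q ⟩ k * ⟨ c * q ⟩ k)
  stepᵣ α A C k = q ^ suc k * ⟨ α ⟩ (suc k) * χ A C k
  step α a c k  = 2# * stepₗ α a c k - (a + c) * stepᵣ α (a * a) (c * c) k

  hₚ : ∀ {n} → (q A C K : Polynomial n) → Polynomial n
  hₚ q A C K = (1ₚ :+ q) :* (1ₚ :+ A :* C :* q :* K) :- q :* (1ₚ :+ K) :* (A :+ C)

  -- The q-difference equation at (u, v) = (a q, c q). The polynomial s was found by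
  -- fitting the partial sums of the right-hand side.

  module Recurrence (a c : Carrier) where
    u v α f g U V : Carrier
    u = a * q
    v = c * q
    α = u * v
    f = a * a * ((1# - v * v) * (1# - v * v * q))
    g = c * c * ((1# - u * u) * (1# - u * u * q))
    U = u * u
    V = v * v

    s : Carrier → Carrier
    s Q = (2# - q * (a * a + c * c) - e * q + e * q * q)
        + ((1# + e * q * q) * (e * q - q * (a * a + c * c)) + e * q * q * (1# + e)) * Q
        + (2# * e * e * e * (q * q * q * q) - e * q * q * q * (a * a + c * c) - e * e * (q * q * q - q * q)) * (Q * Q)
      where e = a * c

    sₚ : ∀ {n} → (a c q Q : Polynomial n) → Polynomial n
    sₚ a c q Q = (1ₚ :+ 1ₚ :- q :* (a :* a :+ c :* c) :- e :* q :+ e :* q :* q)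
        :+ ((1ₚ :+ e :* q :* q) :* (e :* q :- q :* (a :* a :+ c :* c)) :+ e :* q :* q :* (1ₚ :+ e)) :* Q
        :+ ((1ₚ :+ 1ₚ) :* e :* e :* e :* (q :* q :* q :* q) :- e :* q :* q :* q :* (a :* a :+ c :* c) :- e :* e :* (q :* q :* q :- q :* q)) :* (Q :* Q)
      where e = a :* c

    -- What telescoping leaves at the upper end. The factors `⟨ u ⟩ k` and `⟨ U ⟩ k` make it vanish
    -- when `u = q⁻ⁱ` and `k` is large.
    resₗ resᵣ : ℕ → Carrier
    resₗ k = ⟨ u ⟩ k * ⟨ v ⟩ k * ⟨ α * α ⟩ (suc k)
    resᵣ k = ⟨ U ⟩ k * ⟨ V ⟩ k * ⟨ α ⟩ (suc (suc k)) * s (q ^ suc k)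

    -- Without the factors common to all terms this is a polynomial identity in `a`, `c`, `q` and a
    -- power of `q`. The common factors `⟨ u * q ⟩` and `⟨ v * q ⟩` appear only from index 1 on, so
    -- index 0 is treated alone.
    stepₗ-telescopes : ∀ k → f * stepₗ α a v k - g * stepₗ α u c k ≈ (a - c) * (resₗ k * den α k - resₗ (suc k))
    stepₗ-telescopes zero = solve 3 (λ a c q →
      let u = a :* q ; v = c :* q ; α = u :* v ; Z = 1ₚ :* (1ₚ :- α :* α :* 1ₚ) in
      a :* a :* ((1ₚ :- v :* v) :* (1ₚ :- v :* v :* q)) :* (q :* 1ₚ :* Z :* (1ₚ :* 1ₚ))
        :- c :* c :* ((1ₚ :- u :* u) :* (1ₚ :- u :* u :* q)) :* (q :* 1ₚ :* Z :* (1ₚ :* 1ₚ))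
      := (a :- c) :* (1ₚ :* 1ₚ :* Z :* ((1ₚ :+ α :* 1ₚ) :* (1ₚ :- α :* α :* q :* (1ₚ :* 1ₚ)))
        :- 1ₚ :* (1ₚ :- u :* 1ₚ) :* (1ₚ :* (1ₚ :- v :* 1ₚ)) :* (Z :* (1ₚ :- α :* α :* (q :* 1ₚ))))) refl a c q
    stepₗ-telescopes (suc k) = begin
      f * (q ^ suc (suc k) * Z * (⟨ u ⟩ (suc k) * ⟨ v * q ⟩ (suc k))) - g * (q ^ suc (suc k) * Z * (⟨ u * q ⟩ (suc k) * ⟨ v ⟩ (suc k)))
        ≈⟨ minus-cong (*-congˡ (*-congˡ (*-congʳ (⟨⟩-suc u k)))) (*-congˡ (*-congˡ (*-congˡ (⟨⟩-suc v k)))) ⟩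
      f * (q ^ suc (suc k) * Z * ((1# - u) * X * ⟨ v * q ⟩ (suc k))) - g * (q ^ suc (suc k) * Z * (⟨ u * q ⟩ (suc k) * ((1# - v) * Y)))
        ≈⟨ solve 7 (λ a c q P X Y Z →
          let u = a :* q ; v = c :* q ; α = u :* v ; Q = q :* P in
          a :* a :* ((1ₚ :- v :* v) :* (1ₚ :- v :* v :* q)) :* (q :* Q :* Z :* ((1ₚ :- u) :* X :* (Y :* (1ₚ :- v :* q :* P))))
            :- c :* c :* ((1ₚ :- u :* u) :* (1ₚ :- u :* u :* q)) :* (q :* Q :* Z :* (X :* (1ₚ :- u :* q :* P) :* ((1ₚ :- v) :* Y)))
          := (a :- c) :* ((1ₚ :- u) :* X :* ((1ₚ :- v) :* Y) :* Z :* ((1ₚ :+ α :* Q) :* (1ₚ :- α :* α :* q :* (Q :* Q)))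
            :- (1ₚ :- u) :* X :* (1ₚ :- u :* Q) :* ((1ₚ :- v) :* Y :* (1ₚ :- v :* Q)) :* (Z :* (1ₚ :- α :* α :* (q :* Q)))))
          refl a c q (q ^ k) X Y Z ⟩
      (a - c) * ((1# - u) * X * ((1# - v) * Y) * Z * den α (suc k)
        - (1# - u) * X * (1# - u * q ^ suc k) * ((1# - v) * Y * (1# - v * q ^ suc k)) * ⟨ α * α ⟩ (suc (suc (suc k))))
        ≈⟨ *-congˡ (minus-cong (*-congʳ (*-congʳ (*-cong (⟨⟩-suc u k) (⟨⟩-suc v k))))
             (*-congʳ (*-cong (*-congʳ (⟨⟩-suc u k)) (*-congʳ (⟨⟩-suc v k))))) ⟨
      (a - c) * (resₗ (suc k) * den α (suc k) - resₗ (suc (suc k))) ∎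
      where
      X = ⟨ u * q ⟩ k
      Y = ⟨ v * q ⟩ k
      Z = ⟨ α * α ⟩ (suc (suc k))

    -- The start leaves `2# * resₗ 0`, twice the lower end of the left-hand telescoping; this is the
    -- inhomogeneity that cancels in `2 L - R`.
    stepᵣ-base : f * ((a + v) * stepᵣ α (a * a) V 0) - g * ((u + c) * stepᵣ α U (c * c) 0)
               ≈ (a - c) * (2# * resₗ 0 * den α 0 - resᵣ 0)
    stepᵣ-base = solve 3 (λ a c q →
      let u = a :* q ; v = c :* q ; α = u :* v ; Z = 1ₚ :* (1ₚ :- α :* 1ₚ) ; t = q :* 1ₚ :* Z :* (1ₚ :+ q) in
      a :* a :* ((1ₚ :- v :* v) :* (1ₚ :- v :* v :* q)) :* ((a :+ v) :* t)
        :- c :* c :* ((1ₚ :- u :* u) :* (1ₚ :- u :* u :* q)) :* ((u :+ c) :* t)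
      := (a :- c) :* ((1ₚ :+ 1ₚ) :* (1ₚ :* 1ₚ :* (1ₚ :* (1ₚ :- α :* α :* 1ₚ))) :* ((1ₚ :+ α :* 1ₚ) :* (1ₚ :- α :* α :* q :* (1ₚ :* 1ₚ)))
        :- 1ₚ :* 1ₚ :* (Z :* (1ₚ :- α :* (q :* 1ₚ))) :* sₚ a c q (q :* 1ₚ))) refl a c q

    -- The factors `(1 - V)(1 - V q)` of `f` and `(1 - U)(1 - U q)` of `g` complete
    -- `⟨ V * (q * q) ⟩ k` and `⟨ U * (q * q) ⟩ k` to `⟨ V ⟩ (k + 2)` and `⟨ U ⟩ (k + 2)`. Then
    -- `⟨ U ⟩ k`, `⟨ V ⟩ k` and `⟨ α ⟩ (k + 2)` are common to all terms, and the polynomial identity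
    -- satisfied by `s` remains.
    stepᵣ-telescopes : ∀ k → f * ((a + v) * stepᵣ α (a * a) V (suc k)) - g * ((u + c) * stepᵣ α U (c * c) (suc k))
                     ≈ (a - c) * (resᵣ k * den α (suc k) - resᵣ (suc k))
    stepᵣ-telescopes k = begin
      f * ((a + v) * (q ^ suc (suc k) * Z * (⟨ a * a * (q * q) ⟩ k * ⟨ V * (q * q) ⟩ k * h (a * a) V (q ^ suc (suc k)))))
        - g * ((u + c) * (q ^ suc (suc k) * Z * (⟨ U * (q * q) ⟩ k * ⟨ c * c * (q * q) ⟩ k * h U (c * c) (q ^ suc (suc k)))))
        ≈⟨ solve 12 (λ a c F₁ F₂ G₁ G₂ s t h₁ h₂ x y →
             a :* a :* F₁ :* (s :* (t :* (x :* F₂ :* h₁))) :- c :* c :* G₁ :* (y :* (t :* (G₂ :* h₂)))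
             := a :* a :* (s :* (t :* (x :* (F₁ :* F₂) :* h₁))) :- c :* c :* (y :* (t :* (G₁ :* G₂ :* h₂))))
             refl a c ((1# - V) * (1# - V * q)) (⟨ V * (q * q) ⟩ k) ((1# - U) * (1# - U * q)) (⟨ U * (q * q) ⟩ k * ⟨ c * c * (q * q) ⟩ k)
               (a + v) (q ^ suc (suc k) * Z) (h (a * a) V (q ^ suc (suc k))) (h U (c * c) (q ^ suc (suc k))) (⟨ a * a * (q * q) ⟩ k) (u + c) ⟩
      a * a * ((a + v) * (q ^ suc (suc k) * Z * (⟨ a * a * (q * q) ⟩ k * ((1# - V) * (1# - V * q) * ⟨ V * (q * q) ⟩ k) * h (a * a) V (q ^ suc (suc k)))))
        - c * c * ((u + c) * (q ^ suc (suc k) * Z * ((1# - U) * (1# - U * q) * (⟨ U * (q * q) ⟩ k * ⟨ c * c * (q * q) ⟩ k) * h U (c * c) (q ^ suc (suc k)))))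
        ≈⟨ minus-cong
             (*-congˡ (*-congˡ (*-congˡ (*-congʳ (*-cong (⟨⟩-cong k (square a)) (sym (⟨⟩-suc² V k)))))))
             (*-congˡ (*-congˡ (*-congˡ (*-congʳ (trans (sym (*-assoc _ _ _)) (*-cong (sym (⟨⟩-suc² U k)) (⟨⟩-cong k (square c)))))))) ⟩
      a * a * ((a + v) * (q ^ suc (suc k) * Z * (X * ⟨ V ⟩ (suc (suc k)) * h (a * a) V (q ^ suc (suc k)))))
        - c * c * ((u + c) * (q ^ suc (suc k) * Z * (⟨ U ⟩ (suc (suc k)) * Y * h U (c * c) (q ^ suc (suc k)))))
        ≈⟨ solve 7 (λ a c q P X Y Z →
          let u = a :* q ; v = c :* q ; α = u :* v ; U = u :* u ; V = v :* v ; Q = q :* P in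
          a :* a :* ((a :+ v) :* (q :* Q :* Z :* (X :* (Y :* (1ₚ :- V :* P) :* (1ₚ :- V :* Q)) :* hₚ q (a :* a) V (q :* Q))))
            :- c :* c :* ((u :+ c) :* (q :* Q :* Z :* (X :* (1ₚ :- U :* P) :* (1ₚ :- U :* Q) :* Y :* hₚ q U (c :* c) (q :* Q))))
          := (a :- c) :* (X :* Y :* Z :* sₚ a c q Q :* ((1ₚ :+ α :* Q) :* (1ₚ :- α :* α :* q :* (Q :* Q)))
            :- X :* (1ₚ :- U :* P) :* (Y :* (1ₚ :- V :* P)) :* (Z :* (1ₚ :- α :* (q :* Q))) :* sₚ a c q (q :* Q)))
          refl a c q (q ^ k) X Y Z ⟩
      (a - c) * (resᵣ k * den α (suc k) - resᵣ (suc k)) ∎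
      where
      X = ⟨ U ⟩ k
      Y = ⟨ V ⟩ k
      Z = ⟨ α ⟩ (suc (suc k))
      square : ∀ x → x * x * (q * q) ≈ x * q * (x * q)
      square x = solve 2 (λ x q → x :* x :* (q :* q) := x :* q :* (x :* q)) refl x q

    -- The lower ends of the two telescopings cancel, so the right side consists of upper ends only.
    step-recurrence : ∀ k → f * cleared (den α) (step α a v) (suc k) - g * cleared (den α) (step α u c) (suc k)
                          ≈ (a - c) * (resᵣ k - 2# * resₗ (suc k))
    step-recurrence k = trans (cleared-linear (den α) (step α a v) (step α u c) f g (suc k))
      (cleared-telescope (den α) _ (λ k → (a - c) * (resᵣ k - 2# * resₗ (suc k))) base next k)
      where
      split : ∀ k → f * step α a v k - g * step α u c k
                  ≈ 2# * (f * stepₗ α a v k - g * stepₗ α u c k)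
                    - (f * ((a + v) * stepᵣ α (a * a) V k) - g * ((u + c) * stepᵣ α U (c * c) k))
      split k = solve 9 (λ f g t l₁ l₂ s₁ s₂ r₁ r₂ →
        f :* (t :* l₁ :- s₁ :* r₁) :- g :* (t :* l₂ :- s₂ :* r₂)
        := t :* (f :* l₁ :- g :* l₂) :- (f :* (s₁ :* r₁) :- g :* (s₂ :* r₂)))
        refl f g 2# (stepₗ α a v k) (stepₗ α u c k) (a + v) (u + c) (stepᵣ α (a * a) V k) (stepᵣ α U (c * c) k)
      base : f * step α a v 0 - g * step α u c 0 ≈ (a - c) * (resᵣ 0 - 2# * resₗ 1)
      base = trans (split 0) (trans (minus-cong (*-congˡ (stepₗ-telescopes 0)) stepᵣ-base)
        (solve 6 (λ t δ l₀ l₁ r d → t :* (δ :* (l₀ :* d :- l₁)) :- δ :* (t :* l₀ :* d :- r) := δ :* (r :- t :* l₁))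
          refl 2# (a - c) (resₗ 0) (resₗ 1) (resᵣ 0) (den α 0)))
      next : ∀ k → (a - c) * (resᵣ (suc k) - 2# * resₗ (suc (suc k)))
                 ≈ (a - c) * (resᵣ k - 2# * resₗ (suc k)) * den α (suc k) + (f * step α a v (suc k) - g * step α u c (suc k))
      next k = sym (trans (+-congˡ (trans (split (suc k)) (minus-cong (*-congˡ (stepₗ-telescopes (suc k))) (stepᵣ-telescopes k))))
        (solve 7 (λ t δ l₀ l₁ r₀ r₁ d → δ :* (r₀ :- t :* l₀) :* d :+ (t :* (δ :* (l₀ :* d :- l₁)) :- δ :* (r₀ :* d :- r₁))
          := δ :* (r₁ :- t :* l₁))
          refl 2# (a - c) (resₗ (suc k)) (resₗ (suc (suc k))) (resᵣ k) (resᵣ (suc k)) (den α (suc k))))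

  step-cong : ∀ {α α′ a a′ c c′} → α ≈ α′ → a ≈ a′ → c ≈ c′ → ∀ k → step α a c k ≈ step α′ a′ c′ k
  step-cong {α} {α′} {a} {a′} {c} {c′} α≈ a≈ c≈ k = minus-cong
    (*-congˡ (*-cong (*-congˡ (⟨⟩-cong (suc k) (*-cong α≈ α≈))) (*-cong (⟨⟩-cong k (*-congʳ a≈)) (⟨⟩-cong k (*-congʳ c≈)))))
    (*-cong (+-cong a≈ c≈) (*-cong (*-congˡ (⟨⟩-cong (suc k) α≈)) (χ-cong k)))
    where
    A≈ : a * a ≈ a′ * a′
    A≈ = *-cong a≈ a≈
    C≈ : c * c ≈ c′ * c′
    C≈ = *-cong c≈ c≈
    χ-cong : ∀ k → χ (a * a) (c * c) k ≈ χ (a′ * a′) (c′ * c′) k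
    χ-cong zero    = refl
    χ-cong (suc k) = *-cong (*-cong (⟨⟩-cong k (*-congʳ A≈)) (⟨⟩-cong k (*-congʳ C≈)))
      (minus-cong (*-congˡ (+-congˡ (*-congʳ (*-congʳ (*-cong A≈ C≈))))) (*-congˡ (+-cong A≈ C≈)))

  den-cong : ∀ {α α′} → α ≈ α′ → ∀ k → den α k ≈ den α′ k
  den-cong α≈ k = *-cong (+-congˡ (*-congʳ α≈)) (minus-cong refl (*-congʳ (*-congʳ (*-cong α≈ α≈))))

  Step : (α a c : Carrier) → ℕ → Carrier
  Step α a c = cleared (den α) (step α a c)

  Step-cong : ∀ {α α′ a a′ c c′} → α ≈ α′ → a ≈ a′ → c ≈ c′ → ∀ N → Step α a c N ≈ Step α′ a′ c′ N
  Step-cong α≈ a≈ c≈ = cleared-cong (den-cong α≈) (step-cong α≈ a≈ c≈)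

  -- The difference of the two sums as a function of the parameters.

  -- Throughout, κ k = qᵏ⁺¹ / (1 - qᵏ⁺¹).

  module Terms (κ : ℕ → Carrier) where

    -- Numerators over the denominator of index `k + 1`. The factor `1#` in `gap` gives it the
    -- literal form of the right side of `cleared-linear`.
    termₗ termᵣ gap : (α a b : Carrier) → ℕ → Carrier
    termₗ α a b k = ⟨ a ⟩ (suc k) * ⟨ b ⟩ (suc k) * ⟨ α * α ⟩ (suc k) * κ k
    termᵣ α a b k = ⟨ a * a ⟩ (suc k) * ⟨ b * b ⟩ (suc k) * ⟨ α ⟩ (suc k) * κ k
    gap α a b k   = 2# * termₗ α a b k - 1# * termᵣ α a b k

    Gap : (α a b : Carrier) → ℕ → Carrier
    Gap α a b = cleared (den α) (gap α a b)

    Gap-cong : ∀ {α α′ a a′ b b′} → α ≈ α′ → a ≈ a′ → b ≈ b′ → ∀ N → Gap α a b N ≈ Gap α′ a′ b′ N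
    Gap-cong α≈ a≈ b≈ = cleared-cong (den-cong α≈) λ k → minus-cong
      (*-congˡ (*-congʳ (*-cong (*-cong (⟨⟩-cong (suc k) a≈) (⟨⟩-cong (suc k) b≈)) (⟨⟩-cong (suc k) (*-cong α≈ α≈)))))
      (*-congˡ (*-congʳ (*-cong (*-cong (⟨⟩-cong (suc k) (*-cong a≈ a≈)) (⟨⟩-cong (suc k) (*-cong b≈ b≈))) (⟨⟩-cong (suc k) α≈))))

    -- Clearing the denominators makes this possible: `κ` does not depend on `b`, and everything
    -- else is built from `b` by ring operations.
    Gap-polynomial : ∀ a N → IsPolynomial (λ b → Gap (a * b) a b N)
    Gap-polynomial a N = cleared-poly N
      where
      const : ∀ x → IsPolynomial (λ _ → x)
      const = const-polynomial
      α-poly : IsPolynomial (λ b → a * b)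
      α-poly = *-polynomial (const a) id-polynomial
      α²-poly : IsPolynomial (λ b → a * b * (a * b))
      α²-poly = *-polynomial α-poly α-poly
      minus-poly : ∀ {f g} → IsPolynomial f → IsPolynomial g → IsPolynomial (λ b → f b - g b)
      minus-poly p r = +-polynomial p (neg-polynomial r)
      ⟨⟩-poly : ∀ {f} k → IsPolynomial f → IsPolynomial (λ b → ⟨ f b ⟩ k)
      ⟨⟩-poly zero    p = const 1#
      ⟨⟩-poly (suc k) p = *-polynomial (⟨⟩-poly k p) (minus-poly (const 1#) (*-polynomial p (const (q ^ k))))
      den-poly : ∀ k → IsPolynomial (λ b → den (a * b) k)
      den-poly k = *-polynomial (+-polynomial (const 1#) (*-polynomial α-poly (const (q ^ k))))
        (minus-poly (const 1#) (*-polynomial (*-polynomial α²-poly (const q)) (const (q ^ k * q ^ k))))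
      gap-poly : ∀ k → IsPolynomial (λ b → gap (a * b) a b k)
      gap-poly k = minus-poly
        (*-polynomial (const 2#) (*-polynomial (*-polynomial (*-polynomial (const (⟨ a ⟩ (suc k))) (⟨⟩-poly (suc k) id-polynomial)) (⟨⟩-poly (suc k) α²-poly)) (const (κ k))))
        (*-polynomial (const 1#) (*-polynomial (*-polynomial (*-polynomial (const (⟨ a * a ⟩ (suc k)))
          (⟨⟩-poly (suc k) (*-polynomial id-polynomial id-polynomial))) (⟨⟩-poly (suc k) α-poly)) (const (κ k))))
      cleared-poly : ∀ N → IsPolynomial (λ b → cleared (den (a * b)) (gap (a * b) a b) N)
      cleared-poly zero    = const 0#
      cleared-poly (suc k) = +-polynomial (*-polynomial (cleared-poly k) (den-poly k)) (gap-poly k)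

    module _ (κ-spec : ∀ k → κ k * (1# - q ^ suc k) ≈ q ^ suc k) where

      -- Both products contain `⟨ a * q ⟩ k * ⟨ c * q ⟩ k`; the outer factors give `(1 - a K)(1 - c)
      -- - (1 - a)(1 - c K) = (a - c)(1 - K)` with `K = qᵏ⁺¹`.
      shiftₗ : ∀ a c k → ⟨ a * q ⟩ (suc k) * ⟨ c ⟩ (suc k) - ⟨ a ⟩ (suc k) * ⟨ c * q ⟩ (suc k)
                       ≈ (a - c) * (⟨ a * q ⟩ k * ⟨ c * q ⟩ k) * (1# - q ^ suc k)
      shiftₗ a c k = trans (minus-cong (*-congˡ (⟨⟩-suc c k)) (*-congʳ (⟨⟩-suc a k)))
        (solve 6 (λ a c q P X Y → X :* (1ₚ :- a :* q :* P) :* ((1ₚ :- c) :* Y) :- (1ₚ :- a) :* X :* (Y :* (1ₚ :- c :* q :* P))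
          := (a :- c) :* (X :* Y) :* (1ₚ :- q :* P)) refl a c q (q ^ k) (⟨ a * q ⟩ k) (⟨ c * q ⟩ k))

      shiftᵣ : ∀ a c k → ⟨ a * q * (a * q) ⟩ (suc k) * ⟨ c * c ⟩ (suc k) - ⟨ a * a ⟩ (suc k) * ⟨ c * q * (c * q) ⟩ (suc k)
                       ≈ (a - c) * (a + c) * χ (a * a) (c * c) k * (1# - q ^ suc k)
      shiftᵣ a c zero = solve 3 (λ a c q →
        1ₚ :* (1ₚ :- a :* q :* (a :* q) :* 1ₚ) :* (1ₚ :* (1ₚ :- c :* c :* 1ₚ)) :- 1ₚ :* (1ₚ :- a :* a :* 1ₚ) :* (1ₚ :* (1ₚ :- c :* q :* (c :* q) :* 1ₚ))
        := (a :- c) :* (a :+ c) :* (1ₚ :+ q) :* (1ₚ :- q :* 1ₚ)) refl a c q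
      shiftᵣ a c (suc k) = trans
        (minus-cong (*-cong (⟨⟩-cong (suc (suc k)) (square a)) (⟨⟩-suc² (c * c) k))
                    (*-cong (⟨⟩-suc² (a * a) k) (⟨⟩-cong (suc (suc k)) (square c))))
        (solve 6 (λ a c q P X Y → let A = a :* a ; C = c :* c ; Q = q :* P in
          X :* (1ₚ :- A :* (q :* q) :* P) :* (1ₚ :- A :* (q :* q) :* Q) :* ((1ₚ :- C) :* (1ₚ :- C :* q) :* Y)
            :- (1ₚ :- A) :* (1ₚ :- A :* q) :* X :* (Y :* (1ₚ :- C :* (q :* q) :* P) :* (1ₚ :- C :* (q :* q) :* Q))
          := (a :- c) :* (a :+ c) :* (X :* Y :* hₚ q A C (q :* Q)) :* (1ₚ :- q :* Q))
          refl a c q (q ^ k) (⟨ a * a * (q * q) ⟩ k) (⟨ c * c * (q * q) ⟩ k))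
        where
        square : ∀ x → x * q * (x * q) ≈ x * x * (q * q)
        square x = solve 2 (λ x q → x :* q :* (x :* q) := x :* x :* (q :* q)) refl x q

      gap-shift : ∀ α a c k → 1# * gap α (a * q) c k - 1# * gap α a (c * q) k ≈ (a - c) * step α a c k
      gap-shift α a c k = begin
        1# * gap α (a * q) c k - 1# * gap α a (c * q) k
          ≈⟨ solve 12 (λ t x₁ y₁ x₂ y₂ X₁ Y₁ X₂ Y₂ β α κ →
            1ₚ :* (t :* (x₁ :* y₁ :* β :* κ) :- 1ₚ :* (X₁ :* Y₁ :* α :* κ)) :- 1ₚ :* (t :* (x₂ :* y₂ :* β :* κ) :- 1ₚ :* (X₂ :* Y₂ :* α :* κ))
            := (t :* β :* (x₁ :* y₁ :- x₂ :* y₂) :- α :* (X₁ :* Y₁ :- X₂ :* Y₂)) :* κ) refl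
            2# (⟨ a * q ⟩ (suc k)) (⟨ c ⟩ (suc k)) (⟨ a ⟩ (suc k)) (⟨ c * q ⟩ (suc k))
            (⟨ a * q * (a * q) ⟩ (suc k)) (⟨ c * c ⟩ (suc k)) (⟨ a * a ⟩ (suc k)) (⟨ c * q * (c * q) ⟩ (suc k))
            (⟨ α * α ⟩ (suc k)) (⟨ α ⟩ (suc k)) (κ k) ⟩
        (2# * ⟨ α * α ⟩ (suc k) * _ - ⟨ α ⟩ (suc k) * _) * κ k
          ≈⟨ *-congʳ (minus-cong (*-congˡ (shiftₗ a c k)) (*-congˡ (shiftᵣ a c k))) ⟩
        (2# * ⟨ α * α ⟩ (suc k) * ((a - c) * X * m) - ⟨ α ⟩ (suc k) * ((a - c) * (a + c) * χ (a * a) (c * c) k * m)) * κ k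
          ≈⟨ solve 9 (λ t β α δ σ X χ m κ → (t :* β :* (δ :* X :* m) :- α :* (δ :* σ :* χ :* m)) :* κ
               := δ :* (t :* (κ :* m :* β :* X) :- σ :* (κ :* m :* α :* χ)))
               refl 2# (⟨ α * α ⟩ (suc k)) (⟨ α ⟩ (suc k)) (a - c) (a + c) X (χ (a * a) (c * c) k) m (κ k) ⟩
        (a - c) * (2# * (κ k * m * ⟨ α * α ⟩ (suc k) * X) - (a + c) * (κ k * m * ⟨ α ⟩ (suc k) * χ (a * a) (c * c) k))
          ≈⟨ *-congˡ (minus-cong (*-congˡ (*-congʳ (*-congʳ (κ-spec k)))) (*-congˡ (*-congʳ (*-congʳ (κ-spec k))))) ⟩
        (a - c) * step α a c k ∎
        where
        m = 1# - q ^ suc k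
        X = ⟨ a * q ⟩ k * ⟨ c * q ⟩ k

      -- The pairs `(a q, c)` and `(a, c q)` have the same product, so one `α` and one common
      -- denominator serve both.
      Gap-shift : ∀ α a c N → 1# * Gap α (a * q) c N - 1# * Gap α a (c * q) N ≈ (a - c) * Step α a c N
      Gap-shift α a c N = trans (cleared-linear (den α) (gap α (a * q) c) (gap α a (c * q)) 1# 1# N)
        (trans (cleared-cong (λ _ → refl) (gap-shift α a c) N) (sym (cleared-* (den α) (step α a c) (a - c) N)))

    Gap-comm : ∀ α a b N → Gap α a b N ≈ Gap α b a N
    Gap-comm α a b = cleared-cong (λ _ → refl) λ k → minus-cong
      (*-congˡ (*-congʳ (*-congʳ (*-comm _ _)))) (*-congˡ (*-congʳ (*-congʳ (*-comm _ _))))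

    -- Vanishing of the difference when a parameter is `q⁻ⁿ`.

    module Vanishing (κ-spec : ∀ k → κ k * (1# - q ^ suc k) ≈ q ^ suc k)
                     (q#0 : q # 0#) (1-qᵏ#0 : ∀ k → 1# - q ^ suc k # 0#) where

      1-x²#0 : ∀ {x} k → x ≈ q ^ suc k → 1# - x * x # 0#
      1-x²#0 k x≈ = #-congʳ (minus-cong refl (trans (^-homo-* q (suc k) (suc k)) (sym (*-cong x≈ x≈)))) (1-qᵏ#0 (k ℕ.+ suc k))

      1-x²q#0 : ∀ {x} k → x ≈ q ^ suc k → 1# - x * x * q # 0#
      1-x²q#0 k x≈ = #-congʳ (minus-cong refl (trans (*-comm q _) (*-congʳ (trans (^-homo-* q (suc k) (suc k)) (sym (*-cong x≈ x≈))))))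
        (1-qᵏ#0 (suc (k ℕ.+ suc k)))

      -- The recurrence is solved for its leading term. Its upper ends vanish since `u = q⁻ⁱ` and
      -- `U = q⁻²ⁱ`, and `f` is invertible since `a` is and `v` is a positive power of `q`. The
      -- premise keeps the factor `g` so that it also holds where `g` itself is zero.
      Step-advances : ∀ i m M {a} → a * q ^ suc i ≈ 1# → i ℕ.+ i ℕ.< M →
                      Recurrence.g a (q ^ (i ℕ.+ m)) * Step (q ^ suc m) (a * q) (q ^ (i ℕ.+ m)) (suc M) ≈ 0# →
                      Step (q ^ suc m) a (q ^ suc (i ℕ.+ m)) (suc M) ≈ 0#
      Step-advances i m M {a} aqⁱ⁺¹≈1 2i<M previous = trans
        (Step-cong qᵐ⁺¹≈α refl (*-comm q c) (suc M))
        (*-cancelˡ-#0 f#0 (begin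
          f * Step α a v (suc M)
            ≈⟨ solve 2 (λ x y → x := (x :- y) :+ y) refl _ (g * Step α u c (suc M)) ⟩
          (f * Step α a v (suc M) - g * Step α u c (suc M)) + g * Step α u c (suc M)
            ≈⟨ +-cong (step-recurrence M) (trans (*-congˡ (Step-cong (sym qᵐ⁺¹≈α) refl refl (suc M))) previous) ⟩
          (a - c) * (resᵣ M - 2# * resₗ (suc M)) + 0#
            ≈⟨ +-congʳ (*-congˡ (minus-cong resᵣ≈0 (*-congˡ resₗ≈0))) ⟩
          (a - c) * (0# - 2# * 0#) + 0#
            ≈⟨ solve 2 (λ δ t → δ :* (con (+ 0) :- t :* con (+ 0)) :+ con (+ 0) := con (+ 0)) refl (a - c) 2# ⟩
          0# ∎))
        where
        c = q ^ (i ℕ.+ m)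
        open Recurrence a c
        uqⁱ≈1 : u * q ^ i ≈ 1#
        uqⁱ≈1 = trans (*-assoc a q (q ^ i)) aqⁱ⁺¹≈1
        Uq²ⁱ≈1 : U * q ^ (i ℕ.+ i) ≈ 1#
        Uq²ⁱ≈1 = begin
          U * q ^ (i ℕ.+ i)       ≈⟨ *-congˡ (^-homo-* q i i) ⟩
          U * (q ^ i * q ^ i)     ≈⟨ solve 2 (λ u x → u :* u :* (x :* x) := u :* x :* (u :* x)) refl u (q ^ i) ⟩
          u * q ^ i * (u * q ^ i) ≈⟨ *-cong uqⁱ≈1 uqⁱ≈1 ⟩
          1# * 1#                 ≈⟨ *-identityˡ 1# ⟩
          1#                      ∎
        qᵐ⁺¹≈α : q ^ suc m ≈ α
        qᵐ⁺¹≈α = begin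
          q * q ^ m                     ≈⟨ *-identityˡ _ ⟨
          1# * (q * q ^ m)              ≈⟨ *-congʳ uqⁱ≈1 ⟨
          u * q ^ i * (q * q ^ m)       ≈⟨ solve 4 (λ u x q y → u :* x :* (q :* y) := u :* (x :* y :* q)) refl u (q ^ i) q (q ^ m) ⟩
          u * (q ^ i * q ^ m * q)       ≈⟨ *-congˡ (*-congʳ (^-homo-* q i m)) ⟨
          α                             ∎
        f#0 : f # 0#
        f#0 = x#0y#0→xy#0 (x#0y#0→xy#0 a#0 a#0) (x#0y#0→xy#0 (1-x²#0 (i ℕ.+ m) (*-comm c q)) (1-x²q#0 (i ℕ.+ m) (*-comm c q)))
          where
          a#0 : a # 0#
          a#0 = x*y≈1⇒x#0 aqⁱ⁺¹≈1
        resᵣ≈0 : resᵣ M ≈ 0#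
        resᵣ≈0 = x≈0⇒x*y≈0 _ (x≈0⇒x*y≈0 _ (x≈0⇒x*y≈0 _ (⟨⟩-zero M Uq²ⁱ≈1 2i<M)))
        resₗ≈0 : resₗ (suc M) ≈ 0#
        resₗ≈0 = x≈0⇒x*y≈0 _ (x≈0⇒x*y≈0 _ (⟨⟩-zero (suc M) uqⁱ≈1 (ℕₚ.m≤n⇒m≤1+n (ℕₚ.≤-<-trans (ℕₚ.m≤m+n i i) 2i<M))))

      -- The induction starts at `a = q⁻¹`: there `u = 1`, and the factor `1 - u²` of `g` removes
      -- the earlier term.
      Step-vanishes : ∀ i m M {a} → a * q ^ suc i ≈ 1# → i ℕ.+ i ℕ.< M →
                      Step (q ^ suc m) a (q ^ suc (i ℕ.+ m)) (suc M) ≈ 0#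
      Step-vanishes zero m M {a} aq≈1 0<M = Step-advances 0 m M aq≈1 0<M
        (x≈0⇒x*y≈0 _ (x≈0⇒y*x≈0 _ (x≈0⇒x*y≈0 _ (trans (minus-cong refl (trans (*-cong u≈1 u≈1) (*-identityˡ 1#))) (-‿inverseʳ 1#)))))
        where
        u≈1 : a * q ≈ 1#
        u≈1 = trans (*-congˡ (sym (*-identityʳ q))) aq≈1
      Step-vanishes (suc i) m M {a} aqⁱ⁺²≈1 2i+2<M = Step-advances (suc i) m M aqⁱ⁺²≈1 2i+2<M
        (x≈0⇒y*x≈0 _ (Step-vanishes i m M (trans (*-assoc a q (q ^ suc i)) aqⁱ⁺²≈1)
          (ℕₚ.≤-<-trans (ℕₚ.+-mono-≤ (ℕₚ.n≤1+n i) (ℕₚ.n≤1+n i)) 2i+2<M)))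

      -- A walk from `a = 1`, where every numerator contains `1 - 1`, to `a = q⁻ⁱ` with the product
      -- `α` fixed. Each move changes `Gap` by a multiple of a vanishing `Step`.
      Gap-vanishes : ∀ i m M {a} → a * q ^ i ≈ 1# → i ℕ.+ i ℕ.≤ suc M →
                     Gap (q ^ suc m) a (q ^ suc (i ℕ.+ m)) (suc M) ≈ 0#
      Gap-vanishes zero m M {a} a≈1 _ = cleared-zero _ _ (suc M) λ k → trans
        (minus-cong (*-congˡ (x≈0⇒x*y≈0 _ (x≈0⇒x*y≈0 _ (x≈0⇒x*y≈0 _ (⟨⟩-zero (suc k) a≈1 (s≤s z≤n))))))
                    (*-congˡ (x≈0⇒x*y≈0 _ (x≈0⇒x*y≈0 _ (x≈0⇒x*y≈0 _ (⟨⟩-zero (suc k) a²≈1 (s≤s z≤n)))))))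
        (solve 2 (λ s t → s :* con (+ 0) :- t :* con (+ 0) := con (+ 0)) refl 2# 1#)
        where
        a²≈1 : a * a * q ^ 0 ≈ 1#
        a²≈1 = trans (solve 1 (λ a → a :* a :* 1ₚ := a :* 1ₚ :* (a :* 1ₚ)) refl a) (trans (*-cong a≈1 a≈1) (*-identityˡ 1#))
      Gap-vanishes (suc i) m M {a} aqⁱ⁺¹≈1 (s≤s 2i<M) = begin
        Gap α a (q * c) (suc M)
          ≈⟨ Gap-cong refl refl (*-comm q c) (suc M) ⟩
        Gap α a (c * q) (suc M)
          ≈⟨ solve 2 (λ x y → x := y :- (1ₚ :* y :- 1ₚ :* x)) refl _ (Gap α (a * q) c (suc M)) ⟩
        Gap α (a * q) c (suc M) - (1# * Gap α (a * q) c (suc M) - 1# * Gap α a (c * q) (suc M))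
          ≈⟨ minus-cong (Gap-vanishes i m M (trans (*-assoc a q (q ^ i)) aqⁱ⁺¹≈1) (ℕₚ.m≤n⇒m≤1+n (ℕₚ.<⇒≤ 2i<M′)))
               (trans (Gap-shift κ-spec α a c (suc M)) (*-congˡ (Step-vanishes i m M aqⁱ⁺¹≈1 2i<M′))) ⟩
        0# - (a - c) * 0#
          ≈⟨ solve 1 (λ δ → con (+ 0) :- δ :* con (+ 0) := con (+ 0)) refl (a - c) ⟩
        0# ∎
        where
        α = q ^ suc m
        c = q ^ suc (i ℕ.+ m)
        2i<M′ : i ℕ.+ i ℕ.< M
        2i<M′ = ≡.subst (ℕ._≤ M) (ℕₚ.+-suc i i) 2i<M

      qᵏ#0 : ∀ k → q ^ k # 0#
      qᵏ#0 zero    = 1#0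
      qᵏ#0 (suc k) = x#0y#0→xy#0 q#0 (qᵏ#0 k)

      q-powers-apart : ∀ {i j} → i ℕ.< j → q ^ j # q ^ i
      q-powers-apart {i} i<j with ℕₚ.m≤n⇒∃[o]m+o≡n i<j
      ... | (k , ≡.refl) = #-sym (-#0⇒# (#-congʳ eq (x#0y#0→xy#0 (qᵏ#0 i) (1-qᵏ#0 k))))
        where
        eq : q ^ i * (1# - q ^ suc k) ≈ q ^ i - q ^ suc (i ℕ.+ k)
        eq = trans (solve 3 (λ x q y → x :* (1ₚ :- q :* y) := x :- q :* (x :* y)) refl (q ^ i) q (q ^ k))
          (minus-cong refl (*-congˡ (sym (^-homo-* q i k))))

      -- At `b = qⁿ⁺ᵐ⁺¹` the product `a b` is `qᵐ⁺¹`, which the walk handles. These infinitely many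
      -- `b` are mutually apart, so the polynomial in `b` vanishes identically.
      Gap-vanishes-at-q⁻ⁿ : ∀ n M a b → a * q ^ n ≈ 1# → n ℕ.+ n ℕ.≤ suc M → Gap (a * b) a b (suc M) ≈ 0#
      Gap-vanishes-at-q⁻ⁿ n M a b aqⁿ≈1 2n≤M = polynomial-vanishes (Gap-polynomial a (suc M))
        (λ m → q ^ suc (n ℕ.+ m)) (λ i<j → q-powers-apart (s≤s (ℕₚ.+-monoʳ-< n i<j)))
        (λ m → trans (Gap-cong (α≈ m) refl refl (suc M)) (Gap-vanishes n m M aqⁿ≈1 2n≤M)) b
        where
        α≈ : ∀ m → a * q ^ suc (n ℕ.+ m) ≈ q ^ suc m
        α≈ m = begin
          a * (q * q ^ (n ℕ.+ m))    ≈⟨ *-congˡ (*-congˡ (^-homo-* q n m)) ⟩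
          a * (q * (q ^ n * q ^ m))  ≈⟨ solve 4 (λ a q x y → a :* (q :* (x :* y)) := a :* x :* (q :* y)) refl a q (q ^ n) (q ^ m) ⟩
          a * q ^ n * (q * q ^ m)    ≈⟨ *-congʳ aqⁿ≈1 ⟩
          1# * (q * q ^ m)           ≈⟨ *-identityˡ _ ⟩
          q ^ suc m                  ∎

    -- Return from the cleared identity to sums of fractions.

    denominator : (a b : Carrier) → ℕ → Carrier
    denominator a b k = ⟨ - (a * b) ⨾ q ⟩ k * ⟨ a ^ 2 * b ^ 2 * q ⨾ q ^ 2 ⟩ k

    denominator-suc : ∀ a b k → denominator a b (suc k) ≈ denominator a b k * den (a * b) k
    denominator-suc a b k = trans (*-congˡ (*-congˡ (minus-cong refl (*-congˡ (q²ᵏ k)))))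
      (solve 6 (λ a b q P X Y → X :* (1ₚ :- (:- (a :* b)) :* P) :* (Y :* (1ₚ :- a :* (a :* 1ₚ) :* (b :* (b :* 1ₚ)) :* q :* (P :* P)))
        := X :* Y :* ((1ₚ :+ a :* b :* P) :* (1ₚ :- a :* b :* (a :* b) :* q :* (P :* P))))
        refl a b q (q ^ k) (⟨ - (a * b) ⨾ q ⟩ k) (⟨ a ^ 2 * b ^ 2 * q ⨾ q ^ 2 ⟩ k))
      where
      q²ᵏ : ∀ k → (q ^ 2) ^ k ≈ q ^ k * q ^ k
      q²ᵏ zero    = sym (*-identityˡ 1#)
      q²ᵏ (suc k) = trans (*-congˡ (q²ᵏ k)) (solve 2 (λ q P → q :* (q :* 1ₚ) :* (P :* P) := q :* P :* (q :* P)) refl q (q ^ k))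

    -- Over the common denominator `D 2n`, the difference of the two sides has numerator `Gap`.
    sums-agree : ∀ a b n → Gap (a * b) a b (2 ℕ.* n) ≈ 0# → (∀ k → n ℕ.≤ k → termₗ (a * b) a b k ≈ 0#) →
                 denominator a b (2 ℕ.* n) # 0# → (s : Fin n → Carrier) (t : Fin (2 ℕ.* n) → Carrier) →
                 (∀ i → denominator a b (suc (toℕ i)) * s i ≈ termₗ (a * b) a b (toℕ i)) →
                 (∀ i → denominator a b (suc (toℕ i)) * t i ≈ termᵣ (a * b) a b (toℕ i)) →
                 2# * sum s ≈ sum t
    sums-agree a b n Gap≈0 termₗ≈0 D#0 s t s-spec t-spec = x∙y⁻¹≈ε⇒x≈y _ _ (*-cancelˡ-#0 D#0 (begin
      D 2n * (2# * sum s - sum t)                ≈⟨ solve 4 (λ d t x y → d :* (t :* x :- y) := t :* (d :* x) :- 1ₚ :* (d :* y)) refl (D 2n) 2# (sum s) (sum t) ⟩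
      2# * (D 2n * sum s) - 1# * (D 2n * sum t)
        ≈⟨ minus-cong (*-congˡ (≡.subst (λ N → D N * sum s ≈ cleared d (termₗ (a * b) a b) N) (≡.cong (n ℕ.+_) (≡.sym (ℕₚ.+-identityʳ n)))
             (cleared-extend D d (termₗ (a * b) a b) D-suc termₗ≈0 (cleared-sum D d (termₗ (a * b) a b) D-suc n s s-spec) n)))
           (*-congˡ (cleared-sum D d (termᵣ (a * b) a b) D-suc 2n t t-spec)) ⟩
      2# * cleared d (termₗ (a * b) a b) 2n - 1# * cleared d (termᵣ (a * b) a b) 2n
        ≈⟨ cleared-linear d (termₗ (a * b) a b) (termᵣ (a * b) a b) 2# 1# 2n ⟩
      Gap (a * b) a b 2n                         ≈⟨ Gap≈0 ⟩
      0#                                         ∎))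
      where
      2n = 2 ℕ.* n
      D = denominator a b
      d = den (a * b)
      D-suc = denominator-suc a b

module FirstOrderClausen {ℓ ℓ₁ ℓ₂ : Level} (F : HeytingField ℓ ℓ₁ ℓ₂) (q : HeytingField.Carrier F) where
  open HeytingField F
  open HeytingCommutativeRing heytingCommutativeRing using (commutativeRing)
  open HeytingFieldOperations F
  open FieldProperties F
  open QSeries F q
  open RawSemiringDefinitions (Semiring.rawSemiring (CommutativeRing.semiring commutativeRing)) using (sum)
  open SetoidReasoning setoid
  open ℤ-Solver commutativeRing using (solve; _:=_; _:*_; con)

  -- Inverses are unique: `v` agrees with the chosen inverse of `m`, and `u` cancels `d`.
  quotient : ∀ {d m u v x₁ x₂ x₃ x z₁ z₂ z₃ z} (m#0 : m # 0#) → u * d ≈ 1# → v * m ≈ 1# →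
             x₁ ≈ z₁ → x₂ ≈ z₂ → x₃ ≈ z₃ → x ≈ z → d * (x₁ * x₂ * x₃ * u * (x * v)) ≈ z₁ * z₂ * z₃ * (z / m [ m#0 ])
  quotient {d} {m} {u} {v} {x₁} {x₂} {x₃} {x} {z₁} {z₂} {z₃} {z} m#0 ud≈1 vm≈1 x₁≈z₁ x₂≈z₂ x₃≈z₃ x≈z = begin
    d * (x₁ * x₂ * x₃ * u * (x * v))
      ≈⟨ solve 5 (λ d y u x v → d :* (y :* u :* (x :* v)) := y :* (x :* v) :* (u :* d)) refl d (x₁ * x₂ * x₃) u x v ⟩
    x₁ * x₂ * x₃ * (x * v) * (u * d)
      ≈⟨ *-cong (*-cong (*-cong (*-cong x₁≈z₁ x₂≈z₂) x₃≈z₃) (*-cong x≈z v≈m⁻¹)) ud≈1 ⟩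
    z₁ * z₂ * z₃ * (z / m [ m#0 ]) * 1#
      ≈⟨ *-identityʳ _ ⟩
    z₁ * z₂ * z₃ * (z / m [ m#0 ]) ∎
    where
    v≈m⁻¹ : v ≈ m ⁻¹[ m#0 ]
    v≈m⁻¹ = begin
      v                       ≈⟨ *-identityʳ v ⟨
      v * 1#                  ≈⟨ *-congˡ (x⁻¹*x≈1 m#0) ⟨
      v * (m ⁻¹[ m#0 ] * m)   ≈⟨ solve 3 (λ v w m → v :* (w :* m) := v :* m :* w) refl v (m ⁻¹[ m#0 ]) m ⟩
      v * m * m ⁻¹[ m#0 ]     ≈⟨ *-congʳ vm≈1 ⟩
      1# * m ⁻¹[ m#0 ]        ≈⟨ *-identityˡ _ ⟩
      m ⁻¹[ m#0 ]             ∎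

  -- All factors of the summands are implicit arguments: each open ComplexNumbers R
  -- makes new copies of the operations of ℂ, and a conversion check of a whole
  -- summand between two copies unfolds to real and imaginary parts and does not
  -- finish. Unification with the goal solves the factors one by one.

  first-order-clausen :
    ∀ p → p * q ≈ 1# → (1-qᵏ#0 : ∀ k → 1 ℕ.≤ k → 1# - q ^ k # 0#) → ∀ n → 1 ℕ.≤ n → (a b : Carrier) → a ≈ p ^ n ⊎ b ≈ p ^ n →
    let D = λ k → ⟨ - (a * b) ⨾ q ⟩ k * ⟨ a ^ 2 * b ^ 2 * q ⨾ q ^ 2 ⟩ k in
    D (2 ℕ.* n) # 0# →
    {x₁ x₂ x₃ u x v : Fin n → Carrier} {y₁ y₂ y₃ w y z : Fin (2 ℕ.* n) → Carrier} →
    (∀ i → u i * D (suc (toℕ i)) ≈ 1#) → (∀ i → v i * (1# - q ^ suc (toℕ i)) ≈ 1#) →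
    (∀ i → w i * D (suc (toℕ i)) ≈ 1#) → (∀ i → z i * (1# - q ^ suc (toℕ i)) ≈ 1#) →
    (∀ i → x₁ i ≈ ⟨ a ⨾ q ⟩ (suc (toℕ i))) → (∀ i → x₂ i ≈ ⟨ b ⨾ q ⟩ (suc (toℕ i))) →
    (∀ i → x₃ i ≈ ⟨ a ^ 2 * b ^ 2 ⨾ q ⟩ (suc (toℕ i))) → (∀ i → x i ≈ q ^ suc (toℕ i)) →
    (∀ i → y₁ i ≈ ⟨ a ^ 2 ⨾ q ⟩ (suc (toℕ i))) → (∀ i → y₂ i ≈ ⟨ b ^ 2 ⨾ q ⟩ (suc (toℕ i))) →
    (∀ i → y₃ i ≈ ⟨ a * b ⨾ q ⟩ (suc (toℕ i))) → (∀ i → y i ≈ q ^ suc (toℕ i)) →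
    (1# + 1#) * sum (λ i → x₁ i * x₂ i * x₃ i * u i * (x i * v i)) ≈ sum (λ i → y₁ i * y₂ i * y₃ i * w i * (y i * z i))
  -- Matching `n` as a successor makes `2 * n` reduce to the form `suc M` of the vanishing lemmas.
  first-order-clausen p pq≈1 1-qᵏ#0 n@(suc _) 1≤n a b a∨b≈pⁿ D#0 u-inv v-inv w-inv z-inv x₁≈ x₂≈ x₃≈ x≈ y₁≈ y₂≈ y₃≈ y≈ =
    sums-agree a b n (Gap≈0 a∨b≈pⁿ) (termₗ≈0 a∨b≈pⁿ) D#0 _ _
      (λ i → let k = suc (toℕ i) in quotient (1-qᵏ⁺¹#0 (toℕ i)) (u-inv i) (v-inv i)
        (x₁≈ i) (x₂≈ i) (trans (x₃≈ i) (⟨⟩-cong k a²b²≈)) (x≈ i))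
      (λ i → let k = suc (toℕ i) in quotient (1-qᵏ⁺¹#0 (toℕ i)) (w-inv i) (z-inv i)
        (trans (y₁≈ i) (⟨⟩-cong k (square a))) (trans (y₂≈ i) (⟨⟩-cong k (square b))) (y₃≈ i) (y≈ i))
    where
    1-qᵏ⁺¹#0 : ∀ k → 1# - q ^ suc k # 0#
    1-qᵏ⁺¹#0 k = 1-qᵏ#0 (suc k) (s≤s z≤n)
    κ : ℕ → Carrier
    κ k = q ^ suc k / (1# - q ^ suc k) [ 1-qᵏ⁺¹#0 k ]
    open Terms κ
    open Vanishing (λ k → trans (*-comm _ _) (x*[y/x]≈y (q ^ suc k) (1-qᵏ⁺¹#0 k))) (x*y≈1⇒x#0 (trans (*-comm q p) pq≈1)) 1-qᵏ⁺¹#0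
    pᵏqᵏ≈1 : ∀ k → p ^ k * q ^ k ≈ 1#
    pᵏqᵏ≈1 zero    = *-identityˡ 1#
    pᵏqᵏ≈1 (suc k) = trans
      (solve 4 (λ p q x y → p :* x :* (q :* y) := p :* q :* (x :* y)) refl p q (p ^ k) (q ^ k))
      (trans (*-cong pq≈1 (pᵏqᵏ≈1 k)) (*-identityˡ 1#))
    xqⁿ≈1 : ∀ {x} → x ≈ p ^ n → x * q ^ n ≈ 1#
    xqⁿ≈1 x≈ = trans (*-congʳ x≈) (pᵏqᵏ≈1 n)
    2n≤2n : n ℕ.+ n ℕ.≤ 2 ℕ.* n
    2n≤2n = ℕₚ.+-monoʳ-≤ n (ℕₚ.m≤m+n n 0)
    Gap≈0 : a ≈ p ^ n ⊎ b ≈ p ^ n → Gap (a * b) a b (2 ℕ.* n) ≈ 0#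
    Gap≈0 (inj₁ a≈) = Gap-vanishes-at-q⁻ⁿ n _ a b (xqⁿ≈1 a≈) 2n≤2n
    -- `Gap` is symmetric in `a` and `b`, so the roles are exchanged.
    Gap≈0 (inj₂ b≈) = trans (Gap-comm (a * b) a b (2 ℕ.* n)) (trans (Gap-cong (*-comm a b) refl refl (2 ℕ.* n))
      (Gap-vanishes-at-q⁻ⁿ n _ b a (xqⁿ≈1 b≈) 2n≤2n))
    termₗ≈0 : a ≈ p ^ n ⊎ b ≈ p ^ n → ∀ k → n ℕ.≤ k → termₗ (a * b) a b k ≈ 0#
    termₗ≈0 (inj₁ a≈) k n≤k = x≈0⇒x*y≈0 _ (x≈0⇒x*y≈0 _ (x≈0⇒x*y≈0 _ (⟨⟩-zero (suc k) (xqⁿ≈1 a≈) (s≤s n≤k))))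
    termₗ≈0 (inj₂ b≈) k n≤k = x≈0⇒x*y≈0 _ (x≈0⇒x*y≈0 _ (x≈0⇒y*x≈0 _ (⟨⟩-zero (suc k) (xqⁿ≈1 b≈) (s≤s n≤k))))
    square : ∀ x → x ^ 2 ≈ x * x
    square x = *-congˡ (*-identityʳ x)
    a²b²≈ : a ^ 2 * b ^ 2 ≈ a * b * (a * b)
    a²b²≈ = solve 2 (λ a b → a :* (a :* con (+ 1)) :* (b :* (b :* con (+ 1))) := a :* b :* (a :* b)) refl a b

-- Specialisation to the complex numbers.

module ComplexInverse {c ℓ₁ ℓ₂ : Level} (R : RealNumbers c ℓ₁ ℓ₂) where
  open ComplexNumbers R
  private
    module ℝ = RealNumbers R
  open HeytingFieldOperations ℝ.heytingField using () renaming (_⁻¹[_] to _⁻¹ᴿ[_])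
  open ℤ-Solver ℝ.commutativeRing using (solve; _:=_; _:+_; _:*_; _:-_; :-_; con)

  -- The left factor is the normal form of d ⁻¹[ d#0 ], so that unification finds
  -- N#0 and no proof of d # 0# has to be compared.

  conjugate-inverse : ∀ {d : ℂ} {N#0 : normSq (d - 0#) ℝ.# ℝ.0#} → let n = normSq (d - 0#) ⁻¹ᴿ[ N#0 ] in
                      ((re (d - 0#) ℝ.* n) +i (ℝ.- im (d - 0#) ℝ.* n)) * d ≈ 1#
  conjugate-inverse {a +i b} {N#0} =
    ℝ.trans (solve 3 (λ a b n → (a :- con (+ 0)) :* n :* a :- :- (b :- con (+ 0)) :* n :* b
      := ((a :- con (+ 0)) :* (a :- con (+ 0)) :+ (b :- con (+ 0)) :* (b :- con (+ 0)) :- con (+ 0)) :* n) ℝ.refl a b n)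
      (proj₂ (proj₂ (ℝ.#⇒invertible N#0))) ,
    solve 3 (λ a b n → (a :- con (+ 0)) :* n :* b :+ :- (b :- con (+ 0)) :* n :* a := con (+ 0)) ℝ.refl a b n
    where n = normSq ((a +i b) - 0#) ⁻¹ᴿ[ N#0 ]

theorem3p2 : ∀ {c ℓ₁ ℓ₂ : Level} (R : RealNumbers c ℓ₁ ℓ₂) → let open ComplexNumbers R in
    (q : ℂ) (r : ℝ) (r≡∣q∣ : r IsModulusOf q) (0<∣q∣ : 0ᴿ <ᴿ r) (∣q∣<1 : r <ᴿ 1ᴿ)
    (n : ℕ) → 1 ℕ.≤ n →
    (a b : ℂ) →
    let q⁻ⁿ   = q ⁻¹[ ∣q∣>0⇒q#0 r≡∣q∣ 0<∣q∣ ] ^ n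
        D     = λ k → ⟨ - (a * b) ⨾ q ⟩ k * ⟨ a ^ 2 * b ^ 2 * q ⨾ q ^ 2 ⟩ k
        1-qᵏ≠0 = ∣q∣<1⇒1-qᵏ#0 r≡∣q∣ 0<∣q∣ ∣q∣<1
    in
    a ≈ q⁻ⁿ ⊎ b ≈ q⁻ⁿ →
    (D≠0 : ∀ k → 1 ℕ.≤ k → k ℕ.≤ 2 ℕ.* n → D k # 0#) →
    (1# + 1#) * ∑₁ n (λ k 1≤k k≤n →
        (⟨ a ⨾ q ⟩ k * ⟨ b ⨾ q ⟩ k * ⟨ a ^ 2 * b ^ 2 ⨾ q ⟩ k) / D k [ D≠0 k 1≤k (≤-trans k≤n (m≤m+n n _)) ]
          * (q ^ k / (1# - q ^ k) [ 1-qᵏ≠0 k 1≤k ]))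
    ≈ ∑₁ (2 ℕ.* n) (λ k 1≤k k≤2n →
        (⟨ a ^ 2 ⨾ q ⟩ k * ⟨ b ^ 2 ⨾ q ⟩ k * ⟨ a * b ⨾ q ⟩ k) / D k [ D≠0 k 1≤k k≤2n ]
          * (q ^ k / (1# - q ^ k) [ 1-qᵏ≠0 k 1≤k ]))
theorem3p2 R q r r≡∣q∣ 0<∣q∣ ∣q∣<1 n 1≤n a b a∨b≈q⁻ⁿ D≠0 =
  first-order-clausen (q ⁻¹[ q≠0 ]) (x⁻¹*x≈1 q≠0) (∣q∣<1⇒1-qᵏ#0 r≡∣q∣ 0<∣q∣ ∣q∣<1) n 1≤n a b a∨b≈q⁻ⁿ
    -- The denominator of index `2n` is the one cancelled at the end; the hypothesis covers it
    -- because `2n` is at least 1.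
    (D≠0 (2 ℕ.* n) (≤-trans 1≤n (m≤m+n n _)) ℕₚ.≤-refl)
    (λ _ → conjugate-inverse) (λ _ → conjugate-inverse) (λ _ → conjugate-inverse) (λ _ → conjugate-inverse)
    (λ _ → refl) (λ _ → refl) (λ _ → refl) (λ _ → refl) (λ _ → refl) (λ _ → refl) (λ _ → refl) (λ _ → refl)
  where
  open ComplexNumbers R using (complexField; ∣q∣>0⇒q#0; ∣q∣<1⇒1-qᵏ#0)
  open ComplexInverse R
  open HeytingField complexField using (refl)
  open HeytingFieldOperations complexField using (_⁻¹[_])
  open FieldProperties complexField using (x⁻¹*x≈1)
  open FirstOrderClausen complexField q using (first-order-clausen)
  q≠0 = ∣q∣>0⇒q#0 r≡∣q∣ 0<∣q∣
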